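{- Let $k \geq 2$ and $n \geq 1$ be integers. If $\mathcal{F}$ is a locally $k$-wide family of subsets of an $n$-element set, then $|\mathcal{F}| \leq (2k)^{k-1} n$.
   Context: A family $\mathcal{F}$ of subsets of a finite set $X$ is locally $k$-wide iff for every $x \in X$ every antichain (with respect to inclusion) of $\{U \in \mathcal{F} \mid x \in U\}$ has at most $k$ members. -}

module Defs where

open import Data.Nat using (ℕ; _≤_)
open import Data.Fin using (Fin)
open import Data.Fin.Subset using (Subset) renaming (_⊆_ to _⊆ˢ_)
open import Data.Fin.Subset.Properties using () renaming (_∈?_ to _∈ˢ?_)
open import Data.List using (List; length; filter)
open import Data.List.Membership.Propositional using (_∈_)
open import Data.List.Relation.Binary.Subset.Propositional using (_⊆_)
open import Data.List.Relation.Unary.Unique.Propositional using (Unique)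
open import Relation.Binary.PropositionalEquality using (_≡_)

-- Uniqueness makes the length of the list the cardinality of the family.
record Family (n : ℕ) : Set where
  constructor family
  field
    members : List (Subset n)
    unique  : Unique members

open Family public

card : ∀ {n} → Family n → ℕ
card 𝓕 = length (members 𝓕)

Antichain : ∀ {n} → Family n → Set
Antichain {n} 𝓐 =
  ∀ (U V : Subset n) → U ∈ members 𝓐 → V ∈ members 𝓐 → U ⊆ˢ V → U ≡ V

LocallyWide : ∀ {n} → ℕ → Family n → Set
LocallyWide {n} k 𝓕 =
  ∀ (x : Fin n) (𝓐 : Family n) →
  members 𝓐 ⊆ filter (x ∈ˢ?_) (members 𝓕) →
  Antichain 𝓐 →
  card 𝓐 ≤ k

{-# OPTIONS --safe #-}

-- Sets with at most one element number at most n + 1, so let all members of the family G have at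
-- least two points.
--
-- Width 2.  Add the sets in order of increasing size.  The number of sets added so far plus the
-- number of currently maximal ones is at most (points covered) + (points in cores) + (rank of the
-- cores), where a core is the intersection of two incomparable sets and the rank of a hypergraph
-- is the number of points minus the number of components.  Hence |G| < 3n.
--
-- Width k > 2.  Let D(G) consist of the members of G lying below a k-element antichain of G, and
-- L = G ∖ D(G).  A set of L meeting a member of D(D(G)) contains it, since it cannot extend the
-- antichain above it; so L lives on the components of D(D(G)), of which
-- r = rank G − rank D(D(G)) are lost in passing to G.  An irreducible member of L (one that is not
-- a union of smaller members) is charged to one of its components that no smaller member inside
-- it covers: a lost one, or the one that leads its component of G, and then two lost ones share
-- that component.  Sets charged to the same place form an antichain, so at most 3kr/2 members are
-- irreducible; likewise at most kr are minimal.  Above an irreducible member L has width k − 1, so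
-- by induction on k, with the irreducible members as points, |L| ≤ kr + g · 3kr/2, where g is the
-- constant for width k − 1.  Summing over G, D(G), D(D(G)), … telescopes to
-- 2|G| ≤ (2k + 3kg)(rank G + rank D(G)).

module Submission where

open import Defs
open import Data.Fin.Base as F using (Fin)
open import Data.Fin.Induction using (<-wellFounded)
import Data.Fin.Properties as F
open import Data.Fin.Subset using (Subset; ∣_∣; ∁; _∩_; ⁅_⁆; ⊥)
  renaming (_⊆_ to _⊆ˢ_; _∈_ to _∈ˢ_; _∉_ to _∉ˢ_)
open import Data.Fin.Subset.Properties
  using (p⊂q⇒∣p∣<∣q∣; anySubset?; x∈∁p⇒x∉p; x∉p⇒x∈∁p; x∈p⇒x∉∁p; x∈p∩q⁺; x∈p∩q⁻; p∩q⊆p; p∩q⊆q;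
         x∈⁅x⁆; x∈⁅y⁆⇒x≡y; nonempty?; Empty-unique)
  renaming (_⊆?_ to _⊆ˢ?_; _∈?_ to _∈ˢ?_; ⊆-antisym to ⊆ˢ-antisym)
open import Data.List.Base
  using (List; []; _∷_; _++_; length; filter; map; lookup; take; allFin; cartesianProduct)
open import Data.List.Membership.Propositional using (_∈_; lose; find)
open import Data.List.Membership.Propositional.Properties
  using (∈-∃++; ∈-++⁺ˡ; ∈-++⁺ʳ; ∈-++⁻; ∈-filter⁺; ∈-filter⁻; ∈-map⁺; ∈-map⁻; ∈-lookup; ∈-allFin;
         ∈-cartesianProduct⁺; ∈-cartesianProduct⁻)
open import Data.List.Properties
  using (length-++; length-map; length-take; length-filter; length-tabulate; filter-notAll)
open import Data.List.Relation.Binary.Permutation.Propositional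
  using (_↭_; ↭-refl; ↭-sym; ↭-trans; prep; swap; ↭⇒↭ₛ)
open import Data.List.Relation.Binary.Permutation.Propositional.Properties
  using (↭-length; ∈-resp-↭; All-resp-↭)
import Data.List.Relation.Binary.Permutation.Setoid.Properties as Permₛ
open import Data.List.Relation.Unary.All as All using (All; []; _∷_; all?)
import Data.List.Relation.Unary.All.Properties as All
open import Data.List.Relation.Unary.AllPairs as AllPairs using (AllPairs; []; _∷_)
import Data.List.Relation.Unary.AllPairs.Properties as AllPairs
open import Data.List.Relation.Unary.Any as Any using (Any; here; there; any?)
open import Data.List.Relation.Unary.Any.Properties using (lookup-index)
open import Data.List.Relation.Unary.Unique.Propositional using (Unique)
import Data.List.Relation.Unary.Unique.Propositional.Properties as Uniq
open import Data.Nat using (ℕ; zero; suc; _+_; _*_; _^_; _∸_; _≤_; _<_; z≤n; s≤s)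
import Data.Nat.Properties as ℕ
open import Data.Nat.Solver using (module +-*-Solver)
open import Data.Product.Base using (∃; ∃₂; _×_; _,_; proj₁; proj₂; uncurry)
open import Data.Sum.Base as Sum using (_⊎_; inj₁; inj₂)
open import Data.Unit.Base using (⊤; tt)
open import Data.Vec.Base using (tabulate)
open import Data.Vec.Properties using (lookup∘tabulate; []=⇒lookup; lookup⇒[]=)
open import Function.Base using (_∘_; id)
open import Induction.WellFounded using (Acc; acc)
open import Relation.Binary.Definitions using (tri<; tri≈; tri>)
open import Relation.Binary.PropositionalEquality hiding (J)
open import Relation.Nullary using (¬_; Dec; yes; no; does; contradiction)
open import Relation.Nullary.Decidable
  using (¬?; _×-dec_; _⊎-dec_; map′; decidable-stable; dec-true)
open import Relation.Unary using (Decidable)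

private
  variable
    A B : Set
    P Q : A → Set
    n : ℕ
    G H : List (Subset n)
    x y z : Fin n

-- Counting in lists and in `Fin n`.

Unique-length : {xs ys : List A} → Unique xs → (∀ {x} → x ∈ xs → x ∈ ys) → length xs ≤ length ys
Unique-length {xs = []} _ _ = z≤n
Unique-length {xs = x ∷ xs} (x∉ ∷ u) sub with ∈-∃++ (sub (here refl))
... | as , bs , refl = begin
  suc (length xs)             ≤⟨ s≤s (Unique-length u sub′) ⟩
  suc (length (as ++ bs))     ≡⟨ cong suc (length-++ as) ⟩
  suc (length as + length bs) ≡⟨ ℕ.+-suc (length as) (length bs) ⟨
  length as + suc (length bs) ≡⟨ length-++ as ⟨
  length (as ++ x ∷ bs)       ∎
  where
  open ℕ.≤-Reasoning
  sub′ : ∀ {y} → y ∈ xs → y ∈ as ++ bs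
  sub′ y∈ with ∈-++⁻ as (sub (there y∈))
  ... | inj₁ p = ∈-++⁺ˡ p
  ... | inj₂ (here refl) = contradiction refl (All.lookup x∉ y∈)
  ... | inj₂ (there p) = ∈-++⁺ʳ as p

length-split : (P? : Decidable P) (xs : List A) →
  length xs ≡ length (filter P? xs) + length (filter (¬? ∘ P?) xs)
length-split P? [] = refl
length-split P? (x ∷ xs) with P? x
... | yes _ = cong suc (length-split P? xs)
... | no _ = trans (cong suc (length-split P? xs)) (sym (ℕ.+-suc _ _))

-- Induction on `ys`: the elements related to the first `y` form a fibre of size at most `k`, and
-- all others are charged further along. `R` may relate an element to several places.
charge : {R : A → B → Set} (R? : ∀ x y → Dec (R x y)) (k : ℕ) (ys : List B) {xs : List A} →
  Unique xs → (∀ {x} → x ∈ xs → ∃ λ y → y ∈ ys × R x y) →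
  (∀ y zs → Unique zs → (∀ {z} → z ∈ zs → z ∈ xs × R z y) → length zs ≤ k) →
  length xs ≤ length ys * k
charge R? k [] {[]} u ch fib = z≤n
charge R? k [] {x ∷ xs} u ch fib with ch (here refl)
... | _ , () , _
charge {R = R} R? k (y ∷ ys) {xs} u ch fib = begin
  length xs                 ≡⟨ length-split P? xs ⟩
  length (filter P? xs) + length (filter (¬? ∘ P?) xs)
    ≤⟨ ℕ.+-mono-≤ (fib y _ (Uniq.filter⁺ P? u) (∈-filter⁻ P?))
         (charge R? k ys (Uniq.filter⁺ (¬? ∘ P?) u) ch′
           λ w zs uz h → fib w zs uz λ z∈ → proj₁ (∈-filter⁻ (¬? ∘ P?) (proj₁ (h z∈))) , proj₂ (h z∈)) ⟩
  k + length ys * k         ∎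
  where
  open ℕ.≤-Reasoning
  P? : Decidable (λ x → R x y)
  P? x = R? x y
  ch′ : ∀ {x} → x ∈ filter (¬? ∘ P?) xs → ∃ λ w → w ∈ ys × R x w
  ch′ x∈ with ∈-filter⁻ (¬? ∘ P?) {xs = xs} x∈
  ... | x∈xs , ¬r with ch x∈xs
  ... | w , here refl , r = contradiction r ¬r
  ... | w , there w∈ , r = w , w∈ , r

#_ : ∀ {n} {P : Fin n → Set} → Decidable P → ℕ
# P? = length (filter P? (allFin _))

#≤n : ∀ {n} {P : Fin n → Set} (P? : Decidable P) → # P? ≤ n
#≤n {n} P? = ℕ.≤-trans (length-filter P? (allFin n))
  (ℕ.≤-reflexive (length-tabulate (λ x → x)))

-- Covered points, core points and ranks are all counted with `#_`, so every growth estimate comes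
-- down to exhibiting distinct points that newly acquire a property.
#-gain : ∀ {n} {P Q : Fin n → Set} (P? : Decidable P) (Q? : Decidable Q) →
  (∀ {x} → P x → Q x) → (ys : List (Fin n)) → Unique ys →
  (∀ {y} → y ∈ ys → Q y × ¬ P y) → # P? + length ys ≤ # Q?
#-gain {n} P? Q? P⊆Q ys u new = begin
  # P? + length ys                      ≡⟨ length-++ (filter P? (allFin n)) ⟨
  length (filter P? (allFin n) ++ ys)   ≤⟨ Unique-length
      (Uniq.++⁺ (Uniq.filter⁺ P? (Uniq.allFin⁺ n)) u
        λ (p , q) → proj₂ (new q) (proj₂ (∈-filter⁻ P? {xs = allFin n} p))) sub ⟩
  # Q?                                  ∎
  where
  open ℕ.≤-Reasoning
  sub : ∀ {x} → x ∈ filter P? (allFin n) ++ ys → x ∈ filter Q? (allFin n)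
  sub {x} x∈ with ∈-++⁻ (filter P? (allFin n)) x∈
  ... | inj₁ p = ∈-filter⁺ Q? (∈-allFin x) (P⊆Q (proj₂ (∈-filter⁻ P? {xs = allFin n} p)))
  ... | inj₂ q = ∈-filter⁺ Q? (∈-allFin x) (proj₁ (new q))

#-mono : ∀ {n} {P Q : Fin n → Set} (P? : Decidable P) (Q? : Decidable Q) →
  (∀ {x} → P x → Q x) → # P? ≤ # Q?
#-mono P? Q? P⊆Q = subst (_≤ # Q?) (ℕ.+-identityʳ _) (#-gain P? Q? P⊆Q [] [] λ ())

-- Inclusion, size and extremal elements.

⊈-witness : (A B : Subset n) → ¬ (A ⊆ˢ B) → ∃ λ x → x ∈ˢ A × x ∉ˢ B
⊈-witness A B A⊈B with F.any? (λ x → x ∈ˢ? A ×-dec ¬? (x ∈ˢ? B))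
... | yes w = w
... | no ¬w = contradiction (λ {x} x∈A → decidable-stable (x ∈ˢ? B) λ x∉B → ¬w (x , x∈A , x∉B)) A⊈B

-- Turns extremality in size, which `largest` and `smallest` provide, into extremality for
-- inclusion.
⊆-by-size : {A B : Subset n} → A ⊆ˢ B → ∣ B ∣ ≤ ∣ A ∣ → B ⊆ˢ A
⊆-by-size {A = A} {B} A⊆B B≤A with B ⊆ˢ? A
... | yes p = p
... | no ¬p = contradiction (p⊂q⇒∣p∣<∣q∣ (A⊆B , ⊈-witness B A ¬p)) (ℕ.≤⇒≯ B≤A)

abstract
  best : {A : Set} {_≼_ : A → A → Set} → (∀ a → a ≼ a) → (∀ {a b c} → a ≼ b → b ≼ c → a ≼ c) →
    (∀ a b → a ≼ b ⊎ b ≼ a) → ∀ {x} {xs : List A} → x ∈ xs → ∃ λ m → m ∈ xs × ∀ {a} → a ∈ xs → a ≼ m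
  best rfl trn tot {xs = a ∷ []} _ = a , here refl , λ { (here refl) → rfl a }
  best rfl trn tot {xs = a ∷ b ∷ xs} _ with best rfl trn tot {xs = b ∷ xs} (here refl)
  ... | m , m∈ , top with tot a m
  ...   | inj₁ a≼m = m , there m∈ , λ { (here refl) → a≼m ; (there p) → top p }
  ...   | inj₂ m≼a = a , here refl , λ { (here refl) → rfl a ; (there p) → trn (top p) m≼a }

abstract
  largest : {A : Set} (f : A → ℕ) → ∀ {x} {xs : List A} → x ∈ xs → ∃ λ m → m ∈ xs × ∀ {a} → a ∈ xs → f a ≤ f m
  largest f = best {_≼_ = λ a b → f a ≤ f b} (λ _ → ℕ.≤-refl) ℕ.≤-trans (λ a b → ℕ.≤-total (f a) (f b))

abstract
  smallest : {A : Set} (f : A → ℕ) → ∀ {x} {xs : List A} → x ∈ xs → ∃ λ m → m ∈ xs × ∀ {a} → a ∈ xs → f m ≤ f a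
  smallest f = best {_≼_ = λ a b → f b ≤ f a} (λ _ → ℕ.≤-refl) (λ p q → ℕ.≤-trans q p) (λ a b → ℕ.≤-total (f b) (f a))

-- Antichains and width at a point.

Incomparable : Subset n → Subset n → Set
Incomparable A B = ¬ (A ⊆ˢ B) × ¬ (B ⊆ˢ A)

abstract
  incomparable? : (A B : Subset n) → Dec (Incomparable A B)
  incomparable? A B = ¬? (A ⊆ˢ? B) ×-dec ¬? (B ⊆ˢ? A)

incomparable⇒≢ : {A B : Subset n} → Incomparable A B → A ≢ B
incomparable⇒≢ (A⊈B , _) refl = A⊈B λ z → z

-- Incomparable sets are distinct, so `AllPairs Incomparable` excludes repetitions and `length` is
-- the size of the antichain.
Wide : ℕ → List (Subset n) → Set
Wide {n} k G = ∀ (x : Fin n) 𝓐 → AllPairs Incomparable 𝓐 →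
  (∀ {A} → A ∈ 𝓐 → A ∈ G × x ∈ˢ A) → length 𝓐 ≤ k

Wide-⊆ : ∀ {k} → (∀ {A} → A ∈ H → A ∈ G) → Wide k G → Wide k H
Wide-⊆ H⊆G w x 𝓐 inc h = w x 𝓐 inc λ A∈ → H⊆G (proj₁ (h A∈)) , proj₂ (h A∈)

antichain-unique : {𝓐 : List (Subset n)} → AllPairs Incomparable 𝓐 → Unique 𝓐
antichain-unique = AllPairs.map incomparable⇒≢

-- Otherwise `B ∷ 𝓐` would be an antichain of `k + 1` members through `x`.
Wide-comparable : ∀ {k} → Wide k G → (𝓐 : List (Subset n)) → AllPairs Incomparable 𝓐 → length 𝓐 ≡ k →
  ∀ {B} → B ∈ G → x ∈ˢ B → (∀ {A} → A ∈ 𝓐 → A ∈ G × x ∈ˢ A) →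
  ∃ λ A → A ∈ 𝓐 × (A ⊆ˢ B ⊎ B ⊆ˢ A)
Wide-comparable {x = x} w 𝓐 inc len {B} B∈G x∈B h with any? (λ A → A ⊆ˢ? B ⊎-dec B ⊆ˢ? A) 𝓐
... | yes p = find p
... | no ¬p = contradiction
  (w x (B ∷ 𝓐) (All.tabulate (λ A∈ → (λ B⊆A → ¬p (lose A∈ (inj₂ B⊆A))) , λ A⊆B → ¬p (lose A∈ (inj₁ A⊆B))) ∷ inc)
    λ { (here refl) → B∈G , x∈B ; (there A∈) → h A∈ })
  (ℕ.<⇒≱ (ℕ.≤-reflexive (cong suc (sym len))))

-- Existence of a k-element antichain in G, phrased so that it is visibly decidable.
Antichains : ℕ → List (Subset n) → Set
Antichains zero G = ⊤
Antichains (suc k) G = Any (λ A → Antichains k (filter (incomparable? A) G)) G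

abstract
  antichains? : ∀ k (G : List (Subset n)) → Dec (Antichains k G)
  antichains? zero G = yes tt
  antichains? (suc k) G = any? (λ A → antichains? k (filter (incomparable? A) G)) G

antichain⁻ : ∀ k (G : List (Subset n)) → Antichains k G →
  ∃ λ 𝓐 → AllPairs Incomparable 𝓐 × (∀ {A} → A ∈ 𝓐 → A ∈ G) × length 𝓐 ≡ k
antichain⁻ zero G _ = [] , [] , (λ ()) , refl
antichain⁻ (suc k) G ac with find ac
... | A , A∈G , ac′ with antichain⁻ k _ ac′
... | 𝓐 , inc , sub , len = A ∷ 𝓐 , All.tabulate (λ B∈ → proj₂ (∈-filter⁻ (incomparable? A) {xs = G} (sub B∈))) ∷ inc ,
  (λ { (here refl) → A∈G ; (there B∈) → proj₁ (∈-filter⁻ (incomparable? A) (sub B∈)) }) , cong suc len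

antichain⁺ : ∀ {G} (𝓐 : List (Subset n)) → AllPairs Incomparable 𝓐 → (∀ {A} → A ∈ 𝓐 → A ∈ G) →
  Antichains (length 𝓐) G
antichain⁺ [] inc sub = tt
antichain⁺ (A ∷ 𝓐) (incA ∷ inc) sub = lose (sub (here refl))
  (antichain⁺ 𝓐 inc λ B∈ → ∈-filter⁺ (incomparable? A) (sub (there B∈)) (All.lookup incA B∈))

-- Connected components of a hypergraph

-- No edge crosses `s`, so `s` is a union of components, where a point on no edge is a component by
-- itself. Describing connectivity by separating sets instead of paths makes it decidable by a
-- search through subsets.
Closed : List (Subset n) → Subset n → Set
Closed H s = All (λ V → V ⊆ˢ s ⊎ V ⊆ˢ ∁ s) H

abstract
  closed? : (H : List (Subset n)) (s : Subset n) → Dec (Closed H s)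
  closed? H s = all? (λ V → V ⊆ˢ? s ⊎-dec V ⊆ˢ? ∁ s) H

closed⁺ : {H : List (Subset n)} {s : Subset n} →
  (∀ {V} → V ∈ H → ∀ {y} → y ∈ˢ V → y ∈ˢ s → V ⊆ˢ s) → Closed H s
closed⁺ {s = s} h = All.tabulate go
  where
  go : ∀ {V} → V ∈ _ → V ⊆ˢ s ⊎ V ⊆ˢ ∁ s
  go {V} V∈ with F.any? (λ y → y ∈ˢ? V ×-dec y ∈ˢ? s)
  ... | yes (y , y∈V , y∈s) = inj₁ (h V∈ y∈V y∈s)
  ... | no ¬p = inj₂ λ {y} y∈V → x∉p⇒x∈∁p λ y∈s → ¬p (y , y∈V , y∈s)

-- x and y lie in different components: some union of components contains x but not y.
record Apart {n} (H : List (Subset n)) (x y : Fin n) : Set where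
  constructor apart
  field
    side    : Subset n
    closed  : Closed H side
    inside  : x ∈ˢ side
    outside : y ∉ˢ side

abstract
  apart? : (H : List (Subset n)) (x y : Fin n) → Dec (Apart H x y)
  apart? H x y = map′ (λ (s , cl , x∈ , y∉) → apart s cl x∈ y∉) (λ (apart s cl x∈ y∉) → s , cl , x∈ , y∉)
    (anySubset? λ s → closed? H s ×-dec x ∈ˢ? s ×-dec ¬? (y ∈ˢ? s))

apart-sym : Apart H x y → Apart H y x
apart-sym (apart s cl x∈ y∉) = apart (∁ s) (All.map flip cl) (x∉p⇒x∈∁p y∉) (x∈p⇒x∉∁p x∈)
  where
  flip : ∀ {V} → V ⊆ˢ s ⊎ V ⊆ˢ ∁ s → V ⊆ˢ ∁ s ⊎ V ⊆ˢ ∁ (∁ s)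
  flip (inj₁ V⊆s) = inj₂ λ v∈ → x∉p⇒x∈∁p (x∈p⇒x∉∁p (V⊆s v∈))
  flip (inj₂ V⊆∁s) = inj₁ V⊆∁s

apart-cotrans : ∀ {x y} (z : Fin n) → Apart H x y → Apart H x z ⊎ Apart H z y
apart-cotrans z (apart s cl x∈ y∉) with z ∈ˢ? s
... | yes z∈ = inj₂ (apart s cl z∈ y∉)
... | no z∉ = inj₁ (apart s cl x∈ z∉)

¬apart-refl : ¬ Apart H x x
¬apart-refl (apart s _ x∈ x∉) = x∉ x∈

apart-⊆ : (∀ {V} → V ∈ H → V ∈ G) → Apart G x y → Apart H x y
apart-⊆ H⊆G (apart s cl x∈ y∉) = apart s (All.tabulate (λ V∈ → All.lookup cl (H⊆G V∈))) x∈ y∉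

linked-in : ∀ {V} → V ∈ H → x ∈ˢ V → y ∈ˢ V → ¬ Apart H x y
linked-in V∈ x∈V y∈V (apart s cl x∈ y∉) with All.lookup cl V∈
... | inj₁ V⊆s = y∉ (V⊆s y∈V)
... | inj₂ V⊆∁s = x∈∁p⇒x∉p (V⊆∁s x∈V) x∈

linked-trans : ∀ {x y z} → ¬ Apart H x y → ¬ Apart H y z → ¬ Apart H x z
linked-trans {y = y} xy yz xz = Sum.[ xy , yz ]′ (apart-cotrans y xz)

-- The leader of a component is its least point, so the number of non-leaders is the rank of H.
record NonLeader {n} (H : List (Subset n)) (x : Fin n) : Set where
  constructor nonLeader
  field
    smaller : Fin n
    <x      : smaller F.< x
    linked  : ¬ Apart H smaller x

abstract
  nonLeader? : (H : List (Subset n)) (x : Fin n) → Dec (NonLeader H x)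
  nonLeader? H x = map′ (λ (y , y<x , yx) → nonLeader y y<x yx) (λ (nonLeader y y<x yx) → y , y<x , yx)
    (F.any? λ y → y F.<? x ×-dec ¬? (apart? H y x))

rank : List (Subset n) → ℕ
rank H = # nonLeader? H

nonLeader-⊆ : (∀ {V} → V ∈ H → V ∈ G) → NonLeader H x → NonLeader G x
nonLeader-⊆ H⊆G (nonLeader y y<x l) = nonLeader y y<x (l ∘ apart-⊆ H⊆G)

abstract
  leader : (H : List (Subset n)) (x : Fin n) → ∃ λ y → ¬ Apart H y x × ¬ NonLeader H y
  leader H x = go x (<-wellFounded x)
    where
    go : ∀ x → Acc F._<_ x → ∃ λ y → ¬ Apart H y x × ¬ NonLeader H y
    go x (acc rec) with nonLeader? H x
    ... | no ¬nl = x , ¬apart-refl {H = H} , ¬nl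
    ... | yes (nonLeader y y<x yx) with go y (rec y<x)
    ...   | w , wy , lw = w , linked-trans wy yx , lw

leader-unique : ¬ NonLeader H x → ¬ NonLeader H y → ¬ Apart H x y → x ≡ y
leader-unique {H = H} {x = x} {y = y} lx ly xy with F.<-cmp x y
... | tri≈ _ x≡y _ = x≡y
... | tri< x<y _ _ = contradiction (nonLeader x x<y xy) ly
... | tri> _ _ y<x = contradiction (nonLeader y y<x (xy ∘ apart-sym)) lx

rank-mono : (∀ {V} → V ∈ H → V ∈ G) → rank H ≤ rank G
rank-mono {H = H} {G = G} H⊆G = #-mono (nonLeader? H) (nonLeader? G) (nonLeader-⊆ H⊆G)

-- The leaders of the `H`-components of `x` and `y` are distinct but linked in `G`, so the larger of
-- the two stops being a leader.
rank-gain : (∀ {V} → V ∈ H → V ∈ G) → Apart H x y → ¬ Apart G x y → suc (rank H) ≤ rank G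
rank-gain {H = H} {G = G} {x = x} {y = y} H⊆G ap xy with leader H x | leader H y
... | u , ux , lu | v , vy , lv = subst (_≤ rank G) (ℕ.+-comm (rank H) 1)
        (uncurry (λ w p → #-gain (nonLeader? H) (nonLeader? G) (nonLeader-⊆ H⊆G) (w ∷ []) ([] ∷ []) λ { (here refl) → p }) new)
  where
  uv : ¬ Apart G u v
  uv = linked-trans (ux ∘ apart-⊆ H⊆G) (linked-trans xy (vy ∘ apart-⊆ H⊆G ∘ apart-sym))
  new : ∃ λ w → NonLeader G w × ¬ NonLeader H w
  new with F.<-cmp u v
  ... | tri< u<v _ _ = v , nonLeader u u<v uv , lv
  ... | tri> _ _ v<u = u , nonLeader v v<u (uv ∘ apart-sym) , lu
  ... | tri≈ _ refl _ = contradiction ap (linked-trans (ux ∘ apart-sym) vy)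

-- Cores of a family of width two.

Big : Subset n → Set
Big V = ∃₂ λ x y → x ∈ˢ V × y ∈ˢ V × x ≢ y

Covered : List (Subset n) → Fin n → Set
Covered H x = Any (x ∈ˢ_) H

abstract
  covered? : (H : List (Subset n)) (x : Fin n) → Dec (Covered H x)
  covered? H x = any? (x ∈ˢ?_) H

covered-⊆ : (∀ {V} → V ∈ H → V ∈ G) → Covered H x → Covered G x
covered-⊆ H⊆G c with find c
... | V , V∈ , x∈ = lose (H⊆G V∈) x∈

cores : List (Subset n) → List (Subset n)
cores H = map (uncurry _∩_) (filter (uncurry incomparable?) (cartesianProduct H H))

core⁺ : ∀ {A B} → A ∈ H → B ∈ H → Incomparable A B → A ∩ B ∈ cores H
core⁺ A∈ B∈ inc = ∈-map⁺ (uncurry _∩_) (∈-filter⁺ (uncurry incomparable?) (∈-cartesianProduct⁺ A∈ B∈) inc)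

core⁻ : ∀ {K} → K ∈ cores H → ∃₂ λ A B → A ∈ H × B ∈ H × Incomparable A B × K ≡ A ∩ B
core⁻ {H = H} K∈ with ∈-map⁻ (uncurry _∩_) K∈
... | (A , B) , AB∈ , eq with ∈-filter⁻ (uncurry incomparable?) {xs = cartesianProduct H H} AB∈
... | AB∈′ , inc with ∈-cartesianProduct⁻ H H AB∈′
... | A∈ , B∈ = A , B , A∈ , B∈ , inc , eq

cores-⊆ : (∀ {V} → V ∈ H → V ∈ G) → ∀ {K} → K ∈ cores H → K ∈ cores G
cores-⊆ {H = H} H⊆G K∈ with core⁻ {H = H} K∈
... | A , B , A∈ , B∈ , inc , refl = core⁺ (H⊆G A∈) (H⊆G B∈) inc

wide₂ : Wide 2 H → ∀ {P Q C} → P ∈ H → Q ∈ H → C ∈ H → Incomparable P Q →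
  x ∈ˢ P → x ∈ˢ Q → x ∈ˢ C → (P ⊆ˢ C ⊎ Q ⊆ˢ C) ⊎ (C ⊆ˢ P ⊎ C ⊆ˢ Q)
wide₂ w {P} {Q} P∈ Q∈ C∈ inc xP xQ xC
  with Wide-comparable w (P ∷ Q ∷ []) ((inc ∷ []) ∷ [] ∷ []) refl C∈ xC
         (λ { (here refl) → P∈ , xP ; (there (here refl)) → Q∈ , xQ })
... | _ , here refl , inj₁ p = inj₁ (inj₁ p)
... | _ , here refl , inj₂ p = inj₂ (inj₁ p)
... | _ , there (here refl) , inj₁ p = inj₁ (inj₂ p)
... | _ , there (here refl) , inj₂ p = inj₂ (inj₂ p)

-- In a 2-wide family overlapping cores lie in a common core, so a largest core is a whole component.
module _ (w : Wide 2 H) {P Q : Subset n} (P∈ : P ∈ H) (Q∈ : Q ∈ H) (PQ : Incomparable P Q)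
  {y : Fin n} (yP : y ∈ˢ P) (yQ : y ∈ˢ Q)
  (top : ∀ {K} → K ∈ cores H → y ∈ˢ K → ∣ K ∣ ≤ ∣ P ∩ Q ∣) where

  private
    -- A core `X ∩ Y` containing `P ∩ Q` passes through `y`, so it is no larger than `P ∩ Q` and
    -- equals it.
    absorb : ∀ {X Y C} → X ∈ H → Y ∈ H → Incomparable X Y → P ∩ Q ⊆ˢ X → P ∩ Q ⊆ˢ Y →
      C ⊆ˢ X → C ⊆ˢ Y → C ⊆ˢ P ∩ Q
    absorb {X} {Y} X∈ Y∈ inc pX pY cX cY c∈ =
      ⊆-by-size (λ u∈ → x∈p∩q⁺ (pX u∈ , pY u∈))
        (top (core⁺ X∈ Y∈ inc) (x∈p∩q⁺ (pX (x∈p∩q⁺ (yP , yQ)) , pY (x∈p∩q⁺ (yP , yQ)))))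
        (x∈p∩q⁺ (cX c∈ , cY c∈))

    -- Width two at `u` compares each of `P` and `Q` with `A` or `B`. In every consistent case
    -- either `A ∩ B` lies inside both, or some core contains both `P ∩ Q` and `A ∩ B`, and `absorb`
    -- applies.
    join : ∀ {A B u} → A ∈ H → B ∈ H → Incomparable A B →
      u ∈ˢ A → u ∈ˢ B → u ∈ˢ P → u ∈ˢ Q → A ∩ B ⊆ˢ P ∩ Q
    join {A} {B} A∈ B∈ inc uA uB uP uQ
      with wide₂ w A∈ B∈ P∈ inc uA uB uP | wide₂ w A∈ B∈ Q∈ inc uA uB uQ
    ... | inj₁ p | inj₁ q = λ c∈ → x∈p∩q⁺ (below p c∈ , below q c∈)
      where
      below : ∀ {C} → A ⊆ˢ C ⊎ B ⊆ˢ C → A ∩ B ⊆ˢ C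
      below (inj₁ A⊆C) c∈ = A⊆C (p∩q⊆p A B c∈)
      below (inj₂ B⊆C) c∈ = B⊆C (p∩q⊆q A B c∈)
    ... | inj₁ (inj₁ A⊆P) | inj₂ (inj₁ Q⊆A) = contradiction (λ {x} q → A⊆P (Q⊆A q)) (proj₂ PQ)
    ... | inj₁ (inj₂ B⊆P) | inj₂ (inj₂ Q⊆B) = contradiction (λ {x} q → B⊆P (Q⊆B q)) (proj₂ PQ)
    ... | inj₁ (inj₁ A⊆P) | inj₂ (inj₂ Q⊆B) = absorb P∈ B∈
      ((λ P⊆B → proj₁ inc (λ a → P⊆B (A⊆P a))) , λ B⊆P → proj₂ PQ (λ q → B⊆P (Q⊆B q)))
      (p∩q⊆p P Q) (λ c → Q⊆B (p∩q⊆q P Q c)) (λ c → A⊆P (p∩q⊆p A B c)) (p∩q⊆q A B)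
    ... | inj₁ (inj₂ B⊆P) | inj₂ (inj₁ Q⊆A) = absorb P∈ A∈
      ((λ P⊆A → proj₂ inc (λ b → P⊆A (B⊆P b))) , λ A⊆P → proj₂ PQ (λ q → A⊆P (Q⊆A q)))
      (p∩q⊆p P Q) (λ c → Q⊆A (p∩q⊆q P Q c)) (λ c → B⊆P (p∩q⊆q A B c)) (p∩q⊆p A B)
    ... | inj₂ (inj₁ P⊆A) | inj₁ (inj₁ A⊆Q) = contradiction (λ {x} p → A⊆Q (P⊆A p)) (proj₁ PQ)
    ... | inj₂ (inj₂ P⊆B) | inj₁ (inj₂ B⊆Q) = contradiction (λ {x} p → B⊆Q (P⊆B p)) (proj₁ PQ)
    ... | inj₂ (inj₂ P⊆B) | inj₁ (inj₁ A⊆Q) = absorb Q∈ B∈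
      ((λ Q⊆B → proj₁ inc (λ a → Q⊆B (A⊆Q a))) , λ B⊆Q → proj₁ PQ (λ p → B⊆Q (P⊆B p)))
      (p∩q⊆q P Q) (λ c → P⊆B (p∩q⊆p P Q c)) (λ c → A⊆Q (p∩q⊆p A B c)) (p∩q⊆q A B)
    ... | inj₂ (inj₁ P⊆A) | inj₁ (inj₂ B⊆Q) = absorb Q∈ A∈
      ((λ Q⊆A → proj₂ inc (λ b → Q⊆A (B⊆Q b))) , λ A⊆Q → proj₁ PQ (λ p → A⊆Q (P⊆A p)))
      (p∩q⊆q P Q) (λ c → P⊆A (p∩q⊆p P Q c)) (λ c → B⊆Q (p∩q⊆q A B c)) (p∩q⊆p A B)
    ... | inj₂ (inj₁ P⊆A) | inj₂ (inj₂ Q⊆B) = absorb A∈ B∈ inc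
      (λ c → P⊆A (p∩q⊆p P Q c)) (λ c → Q⊆B (p∩q⊆q P Q c)) (p∩q⊆p A B) (p∩q⊆q A B)
    ... | inj₂ (inj₂ P⊆B) | inj₂ (inj₁ Q⊆A) = absorb A∈ B∈ inc
      (λ c → Q⊆A (p∩q⊆q P Q c)) (λ c → P⊆B (p∩q⊆p P Q c)) (p∩q⊆p A B) (p∩q⊆q A B)
    -- With both `P` and `Q` inside `A` nothing is known about `B` yet, so `B` is compared with the
    -- pair `P`, `Q` in turn.
    ... | inj₂ (inj₁ P⊆A) | inj₂ (inj₁ Q⊆A) with wide₂ w P∈ Q∈ B∈ PQ uP uQ uB
    ...   | inj₁ (inj₁ P⊆B) = absorb A∈ B∈ inc
      (λ c → P⊆A (p∩q⊆p P Q c)) (λ c → P⊆B (p∩q⊆p P Q c)) (p∩q⊆p A B) (p∩q⊆q A B)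
    ...   | inj₁ (inj₂ Q⊆B) = absorb A∈ B∈ inc
      (λ c → P⊆A (p∩q⊆p P Q c)) (λ c → Q⊆B (p∩q⊆q P Q c)) (p∩q⊆p A B) (p∩q⊆q A B)
    ...   | inj₂ (inj₁ B⊆P) = contradiction (λ {x} b → P⊆A (B⊆P b)) (proj₂ inc)
    ...   | inj₂ (inj₂ B⊆Q) = contradiction (λ {x} b → Q⊆A (B⊆Q b)) (proj₂ inc)
    join {A} {B} A∈ B∈ inc uA uB uP uQ
        | inj₂ (inj₂ P⊆B) | inj₂ (inj₂ Q⊆B) with wide₂ w P∈ Q∈ A∈ PQ uP uQ uA
    ...   | inj₁ (inj₁ P⊆A) = absorb A∈ B∈ inc
      (λ c → P⊆A (p∩q⊆p P Q c)) (λ c → P⊆B (p∩q⊆p P Q c)) (p∩q⊆p A B) (p∩q⊆q A B)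
    ...   | inj₁ (inj₂ Q⊆A) = absorb A∈ B∈ inc
      (λ c → Q⊆A (p∩q⊆q P Q c)) (λ c → P⊆B (p∩q⊆p P Q c)) (p∩q⊆p A B) (p∩q⊆q A B)
    ...   | inj₂ (inj₁ A⊆P) = contradiction (λ {x} a → P⊆B (A⊆P a)) (proj₁ inc)
    ...   | inj₂ (inj₂ A⊆Q) = contradiction (λ {x} a → Q⊆B (A⊆Q a)) (proj₁ inc)

  top-core-closed : Closed (cores H) (P ∩ Q)
  top-core-closed = closed⁺ λ K∈ u∈K u∈PQ → go (core⁻ {H = H} K∈) u∈K u∈PQ
    where
    go : ∀ {K u} → ∃₂ (λ A B → A ∈ H × B ∈ H × Incomparable A B × K ≡ A ∩ B) →
      u ∈ˢ K → u ∈ˢ P ∩ Q → K ⊆ˢ P ∩ Q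
    go (A , B , A∈ , B∈ , inc , refl) u∈K u∈PQ =
      let uA , uB = x∈p∩q⁻ A B u∈K
          uP , uQ = x∈p∩q⁻ P Q u∈PQ
      in join A∈ B∈ inc uA uB uP uQ

abstract
  top-core : Wide 2 H → Covered (cores H) y → ∃₂ λ P Q → P ∈ H × Q ∈ H × Incomparable P Q ×
    y ∈ˢ P × y ∈ˢ Q × Closed (cores H) (P ∩ Q)
  top-core {H = H} {y = y} w c with find c
  ... | K₀ , K₀∈ , yK₀ with largest ∣_∣ (∈-filter⁺ (y ∈ˢ?_) K₀∈ yK₀)
  ... | K , K∈ , top with ∈-filter⁻ (y ∈ˢ?_) {xs = cores H} K∈
  ... | K∈′ , yK with core⁻ {H = H} K∈′
  ... | P , Q , P∈ , Q∈ , inc , refl with x∈p∩q⁻ P Q yK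
  ... | yP , yQ = P , Q , P∈ , Q∈ , inc , yP , yQ ,
    top-core-closed w P∈ Q∈ inc yP yQ λ K∈ yK → top (∈-filter⁺ (y ∈ˢ?_) K∈ yK)

-- Width two: adding the sets one by one.

gain : List (Subset n) → ℕ
gain H = # covered? H + # covered? (cores H) + rank (cores H)

Maxima : List (Subset n) → List (Subset n) → Set
Maxima M H = (∀ {A} → A ∈ M → A ∈ H) × (∀ {A} → A ∈ H → ∃ λ B → B ∈ M × A ⊆ˢ B) ×
  (∀ {A B} → A ∈ M → B ∈ H → A ⊆ˢ B → B ⊆ˢ A)

module _ {n} (B : Subset n) (H M : List (Subset n)) (w : Wide 2 (B ∷ H))
  (B⊈ : ∀ {V} → V ∈ H → ¬ (B ⊆ˢ V)) (mx : Maxima M H) where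

  private
    H⁺ = B ∷ H
    M⊆H : ∀ {A} → A ∈ M → A ∈ H
    M⊆H = proj₁ mx
    above : ∀ {A} → A ∈ H → ∃ λ C → C ∈ M × A ⊆ˢ C
    above = proj₁ (proj₂ mx)
    maximal : ∀ {A C} → A ∈ M → C ∈ H → A ⊆ˢ C → C ⊆ˢ A
    maximal = proj₂ (proj₂ mx)
    wH : Wide 2 H
    wH = Wide-⊆ there w

    -- The ways in which adding `B` raises `gain` by one at a point `y`: `y` is newly covered, newly
    -- in a core, or a core `A ∩ B` joins the component `P ∩ Q` of `y` to a point `z` outside it.
    data Unit (y : Fin n) : Set where
      fresh : ¬ Covered H y → Unit y
      flag  : ∀ {A} → A ∈ M → y ∈ˢ A → ¬ (A ⊆ˢ B) → ¬ Covered (cores H) y → Unit y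
      merge : ∀ {A P Q} z → A ∈ M → y ∈ˢ A → ¬ (A ⊆ˢ B) →
        P ∈ H → Q ∈ H → Incomparable P Q → y ∈ˢ P → y ∈ˢ Q → Closed (cores H) (P ∩ Q) →
        z ∈ˢ A → z ∈ˢ B → z ∉ˢ P ∩ Q → Unit y

    -- If `y` is covered, some maximal `A` passes through it, and `A ∩ B` is a core of `H⁺` since
    -- neither set contains the other. If `y` lies in an old core already, `P ∩ Q` is its component,
    -- and width two forces `P` or `Q` into `B`.
    unit : ∀ {y} → y ∈ˢ B → (∀ {A} → A ∈ M → y ∈ˢ A → ¬ (A ⊆ˢ B)) → Unit y
    unit {y} yB none with covered? H y | covered? (cores H) y
    ... | no ¬c | _ = fresh ¬c
    ... | yes c | no ¬f with find c
    ...   | A₀ , A₀∈ , yA₀ with above A₀∈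
    ...     | A , A∈ , A₀⊆A = flag A∈ (A₀⊆A yA₀) (none A∈ (A₀⊆A yA₀)) ¬f
    unit {y} yB none | yes c | yes f with top-core wH f
    ... | P , Q , P∈ , Q∈ , inc , yP , yQ , cl with wide₂ w (there P∈) (there Q∈) (here refl) inc yP yQ yB
    ...   | inj₂ (inj₁ B⊆P) = contradiction (λ {x} → B⊆P {x}) (B⊈ P∈)
    ...   | inj₂ (inj₂ B⊆Q) = contradiction (λ {x} → B⊆Q {x}) (B⊈ Q∈)
    -- For a maximal `A` above `P`, the core `A ∩ B` contains `P`, so it links `y` to a point `z` of
    -- `P` outside `Q`.
    ...   | inj₁ (inj₁ P⊆B) with above P∈ | ⊈-witness P Q (proj₁ inc)
    ...     | A , A∈ , P⊆A | z , zP , zQ = merge z A∈ (P⊆A yP) (none A∈ (P⊆A yP))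
      P∈ Q∈ inc yP yQ cl (P⊆A zP) (P⊆B zP) λ z∈ → zQ (p∩q⊆q P Q z∈)
    unit {y} yB none | yes c | yes f | P , Q , P∈ , Q∈ , inc , yP , yQ , cl | inj₁ (inj₂ Q⊆B)
      with above Q∈ | ⊈-witness Q P (proj₂ inc)
    ...     | A , A∈ , Q⊆A | z , zQ , zP = merge z A∈ (Q⊆A yQ) (none A∈ (Q⊆A yQ))
      P∈ Q∈ inc yP yQ cl (Q⊆A zQ) (Q⊆B zQ) λ z∈ → zP (p∩q⊆p P Q z∈)

    new-core : ∀ {A} → A ∈ M → ¬ (A ⊆ˢ B) → A ∩ B ∈ cores H⁺
    new-core A∈ A⊈B = core⁺ (there (M⊆H A∈)) (here refl) (A⊈B , B⊈ (M⊆H A∈))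

    old-core : ∀ {K} → K ∈ cores H → K ∈ cores H⁺
    old-core = cores-⊆ {H = H} {G = H⁺} there

    total : ∀ i j l → # covered? H + i ≤ # covered? H⁺ →
      # covered? (cores H) + j ≤ # covered? (cores H⁺) →
      rank (cores H) + l ≤ rank (cores H⁺) → gain H + (i + j + l) ≤ gain H⁺
    total i j l p q r = ℕ.≤-trans (ℕ.≤-reflexive
      (solve 6 (λ a b c i j l → (a :+ b :+ c) :+ (i :+ j :+ l) := (a :+ i) :+ (b :+ j) :+ (c :+ l)) refl
        (# covered? H) (# covered? (cores H)) (rank (cores H)) i j l))
      (ℕ.+-mono-≤ (ℕ.+-mono-≤ p q) r)
      where open +-*-Solver

    cov : (ys : List (Fin n)) → Unique ys → (∀ {y} → y ∈ ys → y ∈ˢ B × ¬ Covered H y) →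
      # covered? H + length ys ≤ # covered? H⁺
    cov ys u new = #-gain (covered? H) (covered? H⁺) there ys u λ y∈ → here (proj₁ (new y∈)) , proj₂ (new y∈)

    flg : (ys : List (Fin n)) → Unique ys → (∀ {y} → y ∈ ys → Covered (cores H⁺) y × ¬ Covered (cores H) y) →
      # covered? (cores H) + length ys ≤ # covered? (cores H⁺)
    flg ys u new = #-gain (covered? (cores H)) (covered? (cores H⁺)) (covered-⊆ old-core) ys u new

    rnk : ∀ {A P Q y z} → A ∈ M → ¬ (A ⊆ˢ B) → y ∈ˢ A → y ∈ˢ B → z ∈ˢ A → z ∈ˢ B →
      y ∈ˢ P → y ∈ˢ Q → z ∉ˢ P ∩ Q → Closed (cores H) (P ∩ Q) → rank (cores H) + 1 ≤ rank (cores H⁺)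
    rnk A∈ A⊈B yA yB zA zB yP yQ z∉ cl = subst (_≤ rank (cores H⁺)) (ℕ.+-comm 1 (rank (cores H)))
      (rank-gain {H = cores H} {G = cores H⁺} old-core (apart _ cl (x∈p∩q⁺ (yP , yQ)) z∉)
        (linked-in {H = cores H⁺} (new-core A∈ A⊈B) (x∈p∩q⁺ (yA , yB)) (x∈p∩q⁺ (zA , zB))))

    cov₀ = cov [] [] λ ()
    flg₀ = flg [] [] λ ()
    rnk₀ : rank (cores H) + 0 ≤ rank (cores H⁺)
    rnk₀ = subst (_≤ rank (cores H⁺)) (sym (ℕ.+-identityʳ _)) (rank-mono {H = cores H} {G = cores H⁺} old-core)

    cov₁ : ∀ {y} → y ∈ˢ B → ¬ Covered H y → # covered? H + 1 ≤ # covered? H⁺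
    cov₁ yB ¬c = cov (_ ∷ []) ([] ∷ []) λ { (here refl) → yB , ¬c }

    flagged : ∀ {A y} → A ∈ M → ¬ (A ⊆ˢ B) → y ∈ˢ A → y ∈ˢ B → Covered (cores H⁺) y
    flagged A∈ A⊈B yA yB = lose (new-core A∈ A⊈B) (x∈p∩q⁺ (yA , yB))

    flg₁ : ∀ {A y} → A ∈ M → ¬ (A ⊆ˢ B) → y ∈ˢ A → y ∈ˢ B → ¬ Covered (cores H) y →
      # covered? (cores H) + 1 ≤ # covered? (cores H⁺)
    flg₁ A∈ A⊈B yA yB ¬c = flg (_ ∷ []) ([] ∷ []) λ { (here refl) → flagged A∈ A⊈B yA yB , ¬c }

  gain-mono : gain H ≤ gain H⁺
  gain-mono = subst (_≤ gain H⁺) (ℕ.+-identityʳ _) (total 0 0 0 cov₀ flg₀ rnk₀)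

  gain₁ : ∀ {y} → y ∈ˢ B → (∀ {A} → A ∈ M → y ∈ˢ A → ¬ (A ⊆ˢ B)) → gain H + 1 ≤ gain H⁺
  gain₁ yB none with unit yB none
  ... | fresh ¬c = total 1 0 0 (cov₁ yB ¬c) flg₀ rnk₀
  ... | flag A∈ yA A⊈B ¬c = total 0 1 0 cov₀ (flg₁ A∈ A⊈B yA yB ¬c) rnk₀
  ... | merge z A∈ yA A⊈B P∈ Q∈ inc yP yQ cl zA zB z∉ =
    total 0 0 1 cov₀ flg₀ (rnk A∈ A⊈B yA yB zA zB yP yQ z∉ cl)

  -- If the unit at `y₁` is `fresh`, the other point `y₀` yields a second one. Otherwise the first
  -- comes with a maximal set `A₁`, and the second is taken at a point `y₂` of `B` outside `A₁`, so
  -- that the two do not coincide.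
  gain₂ : Big B → (∀ {A} → A ∈ M → ¬ (A ⊆ˢ B)) → gain H + 2 ≤ gain H⁺
  gain₂ (y₁ , y₀ , y₁B , y₀B , y₁≢y₀) none with unit y₁B (λ A∈ _ → none A∈)
  ... | fresh ¬c with unit y₀B (λ A∈ _ → none A∈)
  ...   | fresh ¬c′ = total 2 0 0 (cov (y₁ ∷ y₀ ∷ []) ((y₁≢y₀ ∷ []) ∷ [] ∷ [])
    λ { (here refl) → y₁B , ¬c ; (there (here refl)) → y₀B , ¬c′ }) flg₀ rnk₀
  ...   | flag A∈ yA A⊈B ¬f = total 1 1 0 (cov₁ y₁B ¬c) (flg₁ A∈ A⊈B yA y₀B ¬f) rnk₀
  ...   | merge z A∈ yA A⊈B P∈ Q∈ inc yP yQ cl zA zB z∉ =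
    total 1 0 1 (cov₁ y₁B ¬c) flg₀ (rnk A∈ A⊈B yA y₀B zA zB yP yQ z∉ cl)
  gain₂ (y₁ , y₀ , y₁B , y₀B , y₁≢y₀) none
      | flag {A₁} A₁∈ yA₁ A₁⊈B ¬f₁ with ⊈-witness B A₁ (B⊈ (M⊆H A₁∈))
  ... | y₂ , y₂B , y₂A₁ with unit y₂B (λ A∈ _ → none A∈)
  ...   | fresh ¬c = total 1 1 0 (cov₁ y₂B ¬c) (flg₁ A₁∈ A₁⊈B yA₁ y₁B ¬f₁) rnk₀
  ...   | flag A∈ yA A⊈B ¬f = total 0 2 0 cov₀ (flg (y₁ ∷ y₂ ∷ []) (((λ { refl → y₂A₁ yA₁ }) ∷ []) ∷ [] ∷ [])
    λ { (here refl) → flagged A₁∈ A₁⊈B yA₁ y₁B , ¬f₁ ; (there (here refl)) → flagged A∈ A⊈B yA y₂B , ¬f }) rnk₀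
  ...   | merge z A∈ yA A⊈B P∈ Q∈ inc yP yQ cl zA zB z∉ =
    total 0 1 1 cov₀ (flg₁ A₁∈ A₁⊈B yA₁ y₁B ¬f₁) (rnk A∈ A⊈B yA y₂B zA zB yP yQ z∉ cl)
  gain₂ (y₁ , y₀ , y₁B , y₀B , y₁≢y₀) none
      | merge {A₁} z₁ A₁∈ yA₁ A₁⊈B P₁∈ Q₁∈ inc₁ yP₁ yQ₁ cl₁ zA₁ zB₁ z∉₁ with ⊈-witness B A₁ (B⊈ (M⊆H A₁∈))
  ... | y₂ , y₂B , y₂A₁ with unit y₂B (λ A∈ _ → none A∈)
  ...   | fresh ¬c = total 1 0 1 (cov₁ y₂B ¬c) flg₀ (rnk A₁∈ A₁⊈B yA₁ y₁B zA₁ zB₁ yP₁ yQ₁ z∉₁ cl₁)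
  ...   | flag A∈ yA A⊈B ¬f =
    total 0 1 1 cov₀ (flg₁ A∈ A⊈B yA y₂B ¬f) (rnk A₁∈ A₁⊈B yA₁ y₁B zA₁ zB₁ yP₁ yQ₁ z∉₁ cl₁)
  ...   | merge {A} {P} {Q} z A∈ yA A⊈B P∈ Q∈ inc yP yQ cl zA zB z∉ = total 0 0 2 cov₀ flg₀
    (subst (_≤ rank (cores H⁺)) (ℕ.+-comm 2 (rank (cores H))) (ℕ.≤-trans (s≤s first) second))
    where
    -- Two merges raise the rank twice: once by adding only `A₁ ∩ B` to the old cores, and again on
    -- passing to all cores of `H⁺`, provided that `P ∩ Q` is still closed after the first addition.
    C₁ = (A₁ ∩ B) ∷ cores H
    C₁⊆ : ∀ {K} → K ∈ C₁ → K ∈ cores H⁺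
    C₁⊆ (here refl) = new-core A₁∈ A₁⊈B
    C₁⊆ (there K∈) = old-core K∈
    first : suc (rank (cores H)) ≤ rank C₁
    first = rank-gain {H = cores H} {G = C₁} there (apart _ cl₁ (x∈p∩q⁺ (yP₁ , yQ₁)) z∉₁)
      (linked-in {H = C₁} (here refl) (x∈p∩q⁺ (yA₁ , y₁B)) (x∈p∩q⁺ (zA₁ , zB₁)))
    -- The maximal set A₁ cannot cross the core P ∩ Q, and it misses y₂.
    disjoint : A₁ ∩ B ⊆ˢ ∁ (P ∩ Q)
    disjoint {u} u∈ = x∉p⇒x∈∁p λ u∈PQ → crossing (x∈p∩q⁻ P Q u∈PQ)
      where
      crossing : ¬ (u ∈ˢ P × u ∈ˢ Q)
      crossing (uP , uQ) with wide₂ wH P∈ Q∈ (M⊆H A₁∈) inc uP uQ (p∩q⊆p A₁ B u∈)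
      ... | inj₁ (inj₁ P⊆A₁) = y₂A₁ (P⊆A₁ yP)
      ... | inj₁ (inj₂ Q⊆A₁) = y₂A₁ (Q⊆A₁ yQ)
      ... | inj₂ (inj₁ A₁⊆P) = y₂A₁ (maximal A₁∈ P∈ A₁⊆P yP)
      ... | inj₂ (inj₂ A₁⊆Q) = y₂A₁ (maximal A₁∈ Q∈ A₁⊆Q yQ)
    second : suc (rank C₁) ≤ rank (cores H⁺)
    second = rank-gain {H = C₁} {G = cores H⁺} C₁⊆ (apart (P ∩ Q) (inj₂ disjoint ∷ cl) (x∈p∩q⁺ (yP , yQ)) z∉)
      (linked-in {H = cores H⁺} (new-core A∈ A⊈B) (x∈p∩q⁺ (yA , y₂B)) (x∈p∩q⁺ (zA , zB)))

  -- `M′` gains `B` and loses the `p` maximal sets inside `B`, so the left side grows by `2 - p`.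
  -- This is covered by `gain₂` for `p = 0`, by `gain₁` for `p = 1`, and by monotonicity from
  -- `p = 2` on.
  add : Big B → length H + length M ≤ gain H →
    ∃ λ M′ → Maxima M′ H⁺ × 1 ≤ length M′ × length H⁺ + length M′ ≤ gain H⁺
  add big ih = M′ , mx′ , s≤s z≤n , bound
    where
    inB? = λ A → A ⊆ˢ? B
    rest = filter (¬? ∘ inB?) M
    M′ = B ∷ rest
    mx′ : Maxima M′ H⁺
    mx′ = (λ { (here refl) → here refl ; (there A∈) → there (M⊆H (proj₁ (∈-filter⁻ (¬? ∘ inB?) A∈))) }) , up , mxl
      where
      up : ∀ {A} → A ∈ H⁺ → ∃ λ C → C ∈ M′ × A ⊆ˢ C
      up (here refl) = B , here refl , id
      up (there A∈) with above A∈
      ... | C , C∈ , A⊆C with C ⊆ˢ? B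
      ...   | yes C⊆B = B , here refl , λ a → C⊆B (A⊆C a)
      ...   | no C⊈B = C , there (∈-filter⁺ (¬? ∘ inB?) C∈ C⊈B) , A⊆C
      mxl : ∀ {A C} → A ∈ M′ → C ∈ H⁺ → A ⊆ˢ C → C ⊆ˢ A
      mxl (here refl) (here refl) s = id
      mxl (here refl) (there C∈) s = contradiction (λ {x} → s {x}) (B⊈ C∈)
      mxl (there A∈) (here refl) s = contradiction (λ {x} → s {x}) (proj₂ (∈-filter⁻ (¬? ∘ inB?) {xs = M} A∈))
      mxl (there A∈) (there C∈) s = maximal (proj₁ (∈-filter⁻ (¬? ∘ inB?) A∈)) C∈ s
    conclude : ∀ p g → length (filter inB? M) ≡ p → gain H + g ≤ gain H⁺ → 2 ≤ p + g →
      length H⁺ + length M′ ≤ gain H⁺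
    conclude p g eq gg pg = begin
      suc (length H) + suc (length rest)
        ≡⟨ solve 2 (λ h r → con 1 :+ h :+ (con 1 :+ r) := h :+ r :+ con 2) refl (length H) (length rest) ⟩
      length H + length rest + 2
        ≤⟨ ℕ.+-monoʳ-≤ (length H + length rest) pg ⟩
      length H + length rest + (p + g)
        ≡⟨ solve 4 (λ h r p g → h :+ r :+ (p :+ g) := h :+ (p :+ r) :+ g) refl (length H) (length rest) p g ⟩
      length H + (p + length rest) + g
        ≡⟨ cong (λ m → length H + m + g) (trans (cong (_+ length rest) (sym eq)) (sym (length-split inB? M))) ⟩
      length H + length M + g
        ≤⟨ ℕ.+-monoˡ-≤ g ih ⟩
      gain H + g ≤⟨ gg ⟩
      gain H⁺ ∎
      where
      open ℕ.≤-Reasoning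
      open +-*-Solver
    bound : length H⁺ + length M′ ≤ gain H⁺
    bound with filter inB? M in eq
    ... | [] = conclude 0 2 (cong length eq)
      (gain₂ big λ {A} A∈ A⊆B → case-[] (subst (A ∈_) eq (∈-filter⁺ inB? A∈ A⊆B))) (s≤s (s≤s z≤n))
      where
      case-[] : ∀ {A} → ¬ (A ∈ [])
      case-[] ()
    -- A point of `B` outside `C`, the single maximal set inside `B`, satisfies the hypothesis of
    -- `gain₁`.
    ... | C ∷ [] = conclude 1 1 (cong length eq) (gain₁ (proj₁ (proj₂ wit)) none) (s≤s (s≤s z≤n))
      where
      C∈ : C ∈ M
      C∈ = proj₁ (∈-filter⁻ inB? {xs = M} (subst (C ∈_) (sym eq) (here refl)))
      wit = ⊈-witness B C (B⊈ (M⊆H C∈))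
      none : ∀ {A} → A ∈ M → proj₁ wit ∈ˢ A → ¬ (A ⊆ˢ B)
      none {A} A∈ yA A⊆B with subst (A ∈_) eq (∈-filter⁺ inB? A∈ A⊆B)
      ... | here refl = proj₂ (proj₂ wit) yA
    ... | _ ∷ _ ∷ rs = conclude (2 + length rs) 0 (cong length eq)
      (subst (_≤ gain H⁺) (sym (ℕ.+-identityʳ _)) gain-mono) (s≤s (s≤s z≤n))

-- Decreasing, because `sweep` recurses on the tail and thus adds the sets from the end of the list,
-- smallest first.
BySize : List (Subset n) → Set
BySize = AllPairs λ A B → ∣ B ∣ ≤ ∣ A ∣

insert : (A : Subset n) (H : List (Subset n)) → BySize H → ∃ λ H′ → H′ ↭ A ∷ H × BySize H′
insert A [] [] = A ∷ [] , ↭-refl , [] ∷ []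
insert A (B ∷ H) (b ∷ s) with ℕ.≤-total ∣ B ∣ ∣ A ∣
... | inj₁ B≤A = A ∷ B ∷ H , ↭-refl , (B≤A ∷ All.map (λ C≤B → ℕ.≤-trans C≤B B≤A) b) ∷ b ∷ s
... | inj₂ A≤B with insert A H s
...   | H′ , perm , s′ = B ∷ H′ , ↭-trans (prep B perm) (swap B A ↭-refl) , All-resp-↭ (↭-sym perm) (A≤B ∷ b) ∷ s′

sort : (H : List (Subset n)) → ∃ λ H′ → H′ ↭ H × BySize H′
sort [] = [] , ↭-refl , []
sort (A ∷ H) with sort H
... | H′ , perm , s with insert A H′ s
...   | H″ , perm′ , s′ = H″ , ↭-trans perm′ (prep A perm) , s′

-- The invariant is the last component. Recording that `M` is nonempty unless `H` is empty gives the
-- strict inequality in `two-wide`.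
sweep : (H : List (Subset n)) → AllPairs (λ A B → ¬ (A ⊆ˢ B)) H → All Big H → Wide 2 H →
  ∃ λ M → Maxima M H × (H ≡ [] ⊎ 1 ≤ length M) × length H + length M ≤ gain H
sweep [] _ _ _ = [] , ((λ ()) , (λ ()) , λ ()) , inj₁ refl , z≤n
sweep (B ∷ H) (B⊈ ∷ s) (big ∷ bigs) w with sweep H s bigs (Wide-⊆ there w)
... | M , mx , _ , ih with add B H M w (λ V∈ → All.lookup B⊈ V∈) mx big ih
...   | M′ , mx′ , ne , bd = M′ , mx′ , inj₂ ne , bd

private
  Unique-resp-↭ : ∀ {H G : List (Subset n)} → G ↭ H → Unique G → Unique H
  Unique-resp-↭ {n} perm = Permₛ.Unique-resp-↭ (setoid (Subset n)) (↭⇒↭ₛ perm)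

  ordered : {A B : Subset n} → A ≢ B × ∣ B ∣ ≤ ∣ A ∣ → ¬ (A ⊆ˢ B)
  ordered (A≢B , B≤A) A⊆B = A≢B (⊆ˢ-antisym A⊆B (⊆-by-size A⊆B B≤A))

-- Each term of `gain` is at most `n`. The saved 1 pays for the empty set in the final bound `4 * n`
-- for `k = 2`.
two-wide : (G : List (Subset n)) → Unique G → All Big G → Wide 2 G → G ≡ [] ⊎ length G + 1 ≤ 3 * n
two-wide {n} G u big w with sort G
... | H , perm , s with sweep H (AllPairs.zipWith ordered (Unique-resp-↭ (↭-sym perm) u , s)) (All-resp-↭ (↭-sym perm) big) (Wide-⊆ (∈-resp-↭ perm) w)
...   | M , _ , inj₁ refl , _ = inj₁ (empty G (↭-length perm))
  where
  empty : (G : List (Subset n)) → 0 ≡ length G → G ≡ []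
  empty [] _ = refl
...   | M , _ , inj₂ ne , bd = inj₂ (begin
  length G + 1         ≡⟨ cong (_+ 1) (↭-length perm) ⟨
  length H + 1         ≤⟨ ℕ.+-monoʳ-≤ (length H) ne ⟩
  length H + length M  ≤⟨ bd ⟩
  gain H               ≤⟨ ℕ.+-mono-≤ (ℕ.+-mono-≤ (#≤n (covered? H)) (#≤n (covered? (cores H)))) (#≤n (nonLeader? (cores H))) ⟩
  n + n + n            ≡⟨ solve 1 (λ n → n :+ n :+ n := con 3 :* n) refl n ⟩
  3 * n                ∎)
  where
  open ℕ.≤-Reasoning
  open +-*-Solver

-- Towards larger widths: proper inclusion and the induction hypothesis.

AllPairs-from : {A : Set} {R : A → A → Set} {xs : List A} → Unique xs →
  (∀ {a b} → a ∈ xs → b ∈ xs → a ≢ b → R a b) → AllPairs R xs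
AllPairs-from [] r = []
AllPairs-from (x∉ ∷ u) r = All.tabulate (λ y∈ → r (here refl) (there y∈) (All.lookup x∉ y∈)) ∷
  AllPairs-from u λ a∈ b∈ → r (there a∈) (there b∈)

record Proper {n} (W V : Subset n) : Set where
  constructor proper
  field
    sub    : W ⊆ˢ V
    strict : ¬ (V ⊆ˢ W)

proper? : ∀ {n} (W V : Subset n) → Dec (Proper W V)
proper? W V with W ⊆ˢ? V | V ⊆ˢ? W
... | yes p | no q = yes (proper p q)
... | yes _ | yes q = no λ p → Proper.strict p q
... | no p | _ = no λ q → p (Proper.sub q)

-- The ground set is quantified inside, since the induction step applies the bound to a family on
-- `length J` points.
Bound : ℕ → ℕ → Set
Bound k g = ∀ {m} (G : List (Subset m)) → Unique G → All Big G → Wide k G → length G ≤ g * m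

-- Saturated members and the operators `D` and `L`.

module Saturation (n k : ℕ) where

  Saturated : List (Subset n) → Subset n → Set
  Saturated G V = Antichains k (filter (V ⊆ˢ?_) G)

  abstract
    saturated? : ∀ G V → Dec (Saturated G V)
    saturated? G V = antichains? k (filter (V ⊆ˢ?_) G)

  D L : List (Subset n) → List (Subset n)
  D G = filter (saturated? G) G
  L G = filter (¬? ∘ saturated? G) G

  abstract
    saturated⁻ : ∀ {G V} → Saturated G V → ∃ λ 𝓐 → AllPairs Incomparable 𝓐 ×
      (∀ {A} → A ∈ 𝓐 → A ∈ G × V ⊆ˢ A) × length 𝓐 ≡ k
    saturated⁻ {G} {V} s with antichain⁻ k _ s
    ... | 𝓐 , inc , sub , len = 𝓐 , inc , (λ A∈ → ∈-filter⁻ (V ⊆ˢ?_) (sub A∈)) , len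

  saturated⁺ : ∀ {G V} 𝓐 → AllPairs Incomparable 𝓐 → (∀ {A} → A ∈ 𝓐 → A ∈ G × V ⊆ˢ A) →
    length 𝓐 ≡ k → Saturated G V
  saturated⁺ {G} {V} 𝓐 inc h len = subst (λ k → Antichains k (filter (V ⊆ˢ?_) G)) len
    (antichain⁺ 𝓐 inc λ A∈ → uncurry (∈-filter⁺ (V ⊆ˢ?_)) (h A∈))

  saturated-⊆ : ∀ {G V W} → V ⊆ˢ W → Saturated G W → Saturated G V
  saturated-⊆ {G} V⊆W s with saturated⁻ {G} s
  ... | 𝓐 , inc , h , len = saturated⁺ {G} 𝓐 inc (λ A∈ → proj₁ (h A∈) , λ v → proj₂ (h A∈) (V⊆W v)) len

  D⊆ : ∀ {G V} → V ∈ D G → V ∈ G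
  D⊆ {G} V∈ = proj₁ (∈-filter⁻ (saturated? G) V∈)

  D-saturated : ∀ {G V} → V ∈ D G → Saturated G V
  D-saturated {G} V∈ = proj₂ (∈-filter⁻ (saturated? G) {xs = G} V∈)

  L⊆ : ∀ {G V} → V ∈ L G → V ∈ G
  L⊆ {G} V∈ = proj₁ (∈-filter⁻ (¬? ∘ saturated? G) V∈)

  L-unsaturated : ∀ {G V} → V ∈ L G → ¬ Saturated G V
  L-unsaturated {G} V∈ = proj₂ (∈-filter⁻ (¬? ∘ saturated? G) {xs = G} V∈)

-- One layer: bounding `L G` by the components lost.

module Layer (n k′ g : ℕ) (bound : Bound k′ g) (G : List (Subset n))
  (u : Unique G) (big : All Big G) (w : Wide (suc k′) G) where

  open Saturation n (suc k′)

  D₁ D₂ L₀ : List (Subset n)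
  D₁ = D G
  D₂ = D D₁
  L₀ = L G

  D₂⊆G : ∀ {V} → V ∈ D₂ → V ∈ G
  D₂⊆G Q∈ = D⊆ {G} (D⊆ {D₁} Q∈)

  -- A `k`-element antichain of `D₁` above `Q` passes through `y`, so `B` is comparable with one of
  -- its sets `A`. Were `B` inside `A`, it would inherit the saturation of `A`.
  swallow : ∀ {B Q y} → B ∈ L₀ → Q ∈ D₂ → y ∈ˢ B → y ∈ˢ Q → Q ⊆ˢ B
  swallow {B} {Q} {y} B∈ Q∈ yB yQ with saturated⁻ {D₁} (D-saturated {D₁} Q∈)
  ... | 𝓐 , inc , h , len
    with Wide-comparable w 𝓐 inc len (L⊆ {G} B∈) yB (λ A∈ → D⊆ {G} (proj₁ (h A∈)) , proj₂ (h A∈) yQ)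
  ...   | A , A∈ , inj₁ A⊆B = λ q → A⊆B (proj₂ (h A∈) q)
  ...   | A , A∈ , inj₂ B⊆A = contradiction (saturated-⊆ {G} B⊆A (D-saturated {G} (proj₁ (h A∈)))) (L-unsaturated {G} B∈)

  L-closed : ∀ {B} → B ∈ L₀ → Closed D₂ B
  L-closed B∈ = closed⁺ λ Q∈ yQ yB → swallow B∈ Q∈ yB yQ

  linked⇒∈ : ∀ {B x y} → B ∈ L₀ → ¬ Apart D₂ x y → x ∈ˢ B → y ∈ˢ B
  linked⇒∈ {B} {x} {y} B∈ xy xB = decidable-stable (y ∈ˢ? B) λ y∉ → xy (apart B (L-closed B∈) xB y∉)

  -- As in `swallow`, some `A` of an antichain above `Q` is comparable with `M`; if `M ⊆ A`,
  -- maximality puts `A`, and so `Q`, inside `M`.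
  maximal-closed : ∀ {M} → M ∈ D₁ → (∀ {C} → C ∈ D₁ → M ⊆ˢ C → C ⊆ˢ M) → Closed D₂ M
  maximal-closed {M} M∈ mx = closed⁺ go
    where
    go : ∀ {Q} → Q ∈ D₂ → ∀ {y} → y ∈ˢ Q → y ∈ˢ M → Q ⊆ˢ M
    go Q∈ yQ yM with saturated⁻ {D₁} (D-saturated {D₁} Q∈)
    ... | 𝓐 , inc , h , len
      with Wide-comparable w 𝓐 inc len (D⊆ {G} M∈) yM (λ A∈ → D⊆ {G} (proj₁ (h A∈)) , proj₂ (h A∈) yQ)
    ...   | A , A∈ , inj₁ A⊆M = λ q → A⊆M (proj₂ (h A∈) q)
    ...   | A , A∈ , inj₂ M⊆A = λ q → mx (proj₁ (h A∈)) M⊆A (proj₂ (h A∈) q)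

  abstract
    covered-inside : ∀ {x} → Covered D₂ x → ∃ λ M → M ∈ D₁ × x ∈ˢ M × Closed D₂ M
    covered-inside c with find c
    ... | Q , Q∈ , xQ with saturated⁻ {D₁} (D-saturated {D₁} Q∈)
    ...   | [] , inc , h , ()
    ...   | A ∷ 𝓐 , inc , h , len with largest ∣_∣ (∈-filter⁺ (A ⊆ˢ?_) (proj₁ (h (here refl))) id)
    ...     | M , M∈ , top with ∈-filter⁻ (A ⊆ˢ?_) {xs = D₁} M∈
    ...       | M∈D , A⊆M = M , M∈D , A⊆M (proj₂ (h (here refl)) xQ) ,
      maximal-closed M∈D λ C∈ M⊆C → ⊆-by-size M⊆C (top (∈-filter⁺ (A ⊆ˢ?_) C∈ λ a → M⊆C (A⊆M a)))

  -- A set of L₀ inside a single component of D₂ would lie in a maximal set of D₁, hence in D₁.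
  two-apart : ∀ {V} → V ∈ L₀ → ∃₂ λ x y → x ∈ˢ V × y ∈ˢ V × Apart D₂ x y
  two-apart {V} V∈ = search (F.any? λ x → F.any? λ y → x ∈ˢ? V ×-dec y ∈ˢ? V ×-dec apart? D₂ x y)
    where
    Found = ∃₂ λ x y → x ∈ˢ V × y ∈ˢ V × Apart D₂ x y
    isolated : ∀ {x y} → x ∈ˢ V → y ∈ˢ V → x ≢ y → ¬ Covered D₂ x → Found
    isolated {x} {y} xV yV x≢y ¬c = x , y , xV , yV , apart ⁅ x ⁆
      (closed⁺ λ Q∈ zQ z∈ → contradiction (lose Q∈ (subst (_∈ˢ _) (x∈⁅y⁆⇒x≡y x z∈) zQ)) ¬c)
      (x∈⁅x⁆ x) λ y∈ → x≢y (sym (x∈⁅y⁆⇒x≡y x y∈))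
    trapped : ∀ {x M} → ¬ Found → x ∈ˢ V → M ∈ D₁ → x ∈ˢ M → Closed D₂ M → V ⊆ˢ M
    trapped {x} {M} none xV M∈ xM cl {z} zV = decidable-stable (z ∈ˢ? M) λ z∉ → none (x , z , xV , zV , apart M cl xM z∉)
    connected : ¬ Found → ∀ {x y} → x ∈ˢ V → y ∈ˢ V → x ≢ y → Dec (Covered D₂ x) → Found
    connected none xV yV x≢y (no ¬c) = isolated xV yV x≢y ¬c
    connected none xV yV x≢y (yes c) =
      let M , M∈ , xM , cl = covered-inside c in
      contradiction (saturated-⊆ {G} (trapped none xV M∈ xM cl) (D-saturated {G} M∈)) (L-unsaturated {G} V∈)
    search : Dec Found → Found
    search (yes p) = p
    search (no none) =
      let x , y , xV , yV , x≢y = All.lookup big (L⊆ {G} V∈) in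
      connected none xV yV x≢y (covered? D₂ x)

  -- The leader of a `D₂`-component that is lost on passing to `G`, where it is linked to a smaller
  -- point.
  New : Fin n → Set
  New x = NonLeader G x × ¬ NonLeader D₂ x

  abstract
    new? : ∀ x → Dec (New x)
    new? x = nonLeader? G x ×-dec ¬? (nonLeader? D₂ x)

  N : List (Fin n)
  N = filter new? (allFin n)

  ∈N⁻ : ∀ {x} → x ∈ N → New x
  ∈N⁻ x∈ = proj₂ (∈-filter⁻ new? {xs = allFin n} x∈)

  ∈N⁺ : ∀ {x} → New x → x ∈ N
  ∈N⁺ {x} p = ∈-filter⁺ new? (∈-allFin x) p

  uniqueN : Unique N
  uniqueN = Uniq.filter⁺ new? (Uniq.allFin⁺ n)

  rank-N : rank D₂ + length N ≤ rank G
  rank-N = #-gain (nonLeader? D₂) (nonLeader? G) (nonLeader-⊆ D₂⊆G) N uniqueN ∈N⁻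

  linked : ∀ {V x y} → V ∈ L₀ → x ∈ˢ V → y ∈ˢ V → ¬ Apart G x y
  linked V∈ = linked-in {H = G} (L⊆ {G} V∈)

  abstract
    -- A member of `L₀` is a union of `D₂`-components, so it contains their leaders, and `two-apart`
    -- supplies two components.
    two-leaders : ∀ {V} → V ∈ L₀ → ∃₂ λ x y → x ∈ˢ V × y ∈ˢ V × x ≢ y × ¬ NonLeader D₂ x × ¬ NonLeader D₂ y
    two-leaders V∈ with two-apart V∈
    ... | x , y , xV , yV , ap with leader D₂ x | leader D₂ y
    ...   | a , ax , la | b , by , lb = a , b , linked⇒∈ V∈ (ax ∘ apart-sym) xV , linked⇒∈ V∈ (by ∘ apart-sym) yV ,
      (λ { refl → linked-trans (ax ∘ apart-sym) by ap }) , la , lb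

  abstract
    -- `V` links its two `D₂`-leaders in `G`, and a component of `G` has only one leader.
    some-new : ∀ {V} → V ∈ L₀ → ∃ λ x → x ∈ N × x ∈ˢ V
    some-new V∈ with two-leaders V∈
    ... | x , y , xV , yV , x≢y , lx , ly with nonLeader? G x | nonLeader? G y
    ...   | yes p | _ = x , ∈N⁺ (p , lx) , xV
    ...   | no _ | yes q = y , ∈N⁺ (q , ly) , yV
    ...   | no p | no q = contradiction (leader-unique p q (linked V∈ xV yV)) x≢y

  -- Charging the irreducible members.

  Split : Subset n → Fin n → Set
  Split V x = Any (λ W → Proper W V × x ∈ˢ W) L₀

  split? : ∀ V x → Dec (Split V x)
  split? V x = any? (λ W → proper? W V ×-dec x ∈ˢ? W) L₀

  -- For `V` in `L₀` this is minimality among the members of `L₀` through `x`, so the sets uncovered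
  -- at one point form an antichain.
  Uncovered : Subset n → Fin n → Set
  Uncovered V x = x ∈ˢ V × ¬ Split V x

  uncovered? : ∀ V x → Dec (Uncovered V x)
  uncovered? V x = x ∈ˢ? V ×-dec ¬? (split? V x)

  uncovered-⊆ : ∀ {V U x} → Uncovered V x → U ∈ L₀ → U ⊆ˢ V → x ∈ˢ U → V ⊆ˢ U
  uncovered-⊆ {V} {U} (_ , ¬s) U∈ U⊆V xU with V ⊆ˢ? U
  ... | yes V⊆U = V⊆U
  ... | no V⊈U = contradiction (lose U∈ (proper U⊆V V⊈U , xU)) ¬s

  uncovered-fibre : ∀ x zs → Unique zs → (∀ {V} → V ∈ zs → V ∈ L₀ × Uncovered V x) → length zs ≤ suc k′
  uncovered-fibre x zs uz h = w x zs (AllPairs-from uz inc) λ V∈ → L⊆ {G} (proj₁ (h V∈)) , proj₁ (proj₂ (h V∈))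
    where
    back : ∀ {V W} → V ∈ zs → W ∈ zs → V ⊆ˢ W → W ⊆ˢ V
    back V∈ W∈ V⊆W = uncovered-⊆ (proj₂ (h W∈)) (proj₁ (h V∈)) V⊆W (proj₁ (proj₂ (h V∈)))
    inc : ∀ {V W} → V ∈ zs → W ∈ zs → V ≢ W → Incomparable V W
    inc V∈ W∈ V≢W = (λ V⊆W → V≢W (⊆ˢ-antisym V⊆W (back V∈ W∈ V⊆W))) , λ W⊆V → V≢W (⊆ˢ-antisym (back W∈ V∈ W⊆V) W⊆V)

  Irreducible : Subset n → Set
  Irreducible V = ∃ (Uncovered V)

  abstract
    irreducible? : ∀ V → Dec (Irreducible V)
    irreducible? V = F.any? (uncovered? V)

  J : List (Subset n)
  J = filter irreducible? L₀

  J⊆L : ∀ {V} → V ∈ J → V ∈ L₀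
  J⊆L V∈ = proj₁ (∈-filter⁻ irreducible? V∈)

  abstract
    -- A smallest member of `L₀` inside `V` through `x` is uncovered at `x`.
    below : ∀ {V x} → V ∈ L₀ → x ∈ˢ V → ∃ λ I → I ∈ J × x ∈ˢ I × I ⊆ˢ V
    below {V} {x} V∈ xV with smallest ∣_∣ (∈-filter⁺ (λ W → x ∈ˢ? W ×-dec W ⊆ˢ? V) V∈ (xV , id))
    ... | I , I∈ , least with ∈-filter⁻ (λ W → x ∈ˢ? W ×-dec W ⊆ˢ? V) {xs = L₀} I∈
    ...   | I∈L , xI , I⊆V = I , ∈-filter⁺ irreducible? I∈L (x , xI , unc) , xI , I⊆V
      where
      unc : ¬ Split I x
      unc s with find s
      ... | W , W∈ , proper W⊆I I⊈W , xW =
        I⊈W (⊆-by-size W⊆I (least (∈-filter⁺ (λ W → x ∈ˢ? W ×-dec W ⊆ˢ? V) W∈ (xW , λ z → I⊆V (W⊆I z)))))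

  -- These leaders of `G` are the charging places beside `N`. Each is paid for by two lost leaders
  -- in its component, so they number at most half of `length N`.
  Wealthy : Fin n → Set
  Wealthy x = ¬ NonLeader G x × ∃₂ λ y z → y ≢ z × (New y × ¬ Apart G x y) × (New z × ¬ Apart G x z)

  abstract
    wealthy? : ∀ x → Dec (Wealthy x)
    wealthy? x = ¬? (nonLeader? G x) ×-dec F.any? λ y → F.any? λ z →
      ¬? (y F.≟ z) ×-dec (new? y ×-dec ¬? (apart? G x y)) ×-dec (new? z ×-dec ¬? (apart? G x z))

  W : List (Fin n)
  W = filter wealthy? (allFin n)

  abstract
    -- The lost leaders listed for different wealthy points are distinct because they lie in
    -- different components of `G`.
    double : ∀ ws → Unique ws → All Wealthy ws → ∃ λ zs → Unique zs × length zs ≡ 2 * length ws ×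
      All (λ z → z ∈ N × ∃ λ x → x ∈ ws × ¬ Apart G x z) zs
    double [] _ _ = [] , [] , refl , []
    double (x ∷ ws) (x∉ ∷ uw) ((lx , y , z , y≢z , (ny , xy) , nz , xz) ∷ ww) with double ws uw ww
    ... | zs , uz , len , h = y ∷ z ∷ zs , (y≢z ∷ fresh xy) ∷ fresh xz ∷ uz ,
      trans (cong (suc ∘ suc) len) (sym (ℕ.*-suc 2 (length ws))) ,
      (∈N⁺ ny , x , here refl , xy) ∷ (∈N⁺ nz , x , here refl , xz) ∷
        All.map (λ (z∈ , v , v∈ , vz) → z∈ , v , there v∈ , vz) h
      where
      fresh : ∀ {y} → ¬ Apart G x y → All (y ≢_) zs
      fresh xy = All.map (λ { (_ , v , v∈ , vy) refl → All.lookup x∉ v∈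
        (leader-unique lx (proj₁ (All.lookup ww v∈)) (linked-trans xy (vy ∘ apart-sym))) }) h

  length-W : 2 * length W ≤ length N
  length-W with double W (Uniq.filter⁺ wealthy? (Uniq.allFin⁺ n)) (All.all-filter wealthy? (allFin n))
  ... | zs , uz , len , h = subst (_≤ length N) len (Unique-length uz λ z∈ → proj₁ (All.lookup h z∈))

  -- If `V` is uncovered at `x₀`, it is so at the leader `x` of the `D₂`-component of `x₀`, because
  -- members of `L₀` are unions of components. Either `x` is new, or it leads its component of `G`
  -- and every other `D₂`-leader in `V` is new.
  charge-irreducible : ∀ {V} → V ∈ J → ∃ λ x → x ∈ N ++ W × Uncovered V x
  charge-irreducible {V} V∈J with ∈-filter⁻ irreducible? {xs = L₀} V∈J
  ... | V∈ , x₀ , x₀V , unc₀ with leader D₂ x₀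
  ...   | x , xx₀ , lx = go (nonLeader? G x)
    where
    xV : x ∈ˢ V
    xV = linked⇒∈ V∈ (xx₀ ∘ apart-sym) x₀V
    unc : Uncovered V x
    unc = xV , λ s → let U , U∈ , p , xU = find s in unc₀ (lose U∈ (p , linked⇒∈ U∈ xx₀ xU))
    other-new : ¬ NonLeader G x → ∀ {y} → y ∈ˢ V → x ≢ y → ¬ NonLeader D₂ y → New y
    other-new gx {y} yV x≢y ly = decidable-stable (nonLeader? G y)
      (λ gy → x≢y (leader-unique gx gy (linked V∈ xV yV))) , ly
    another : ∃ λ y → y ∈ˢ V × x ≢ y × ¬ NonLeader D₂ y
    another with two-leaders V∈
    ... | a , b , aV , bV , a≢b , la , lb with x F.≟ a
    ...   | yes refl = b , bV , a≢b , lb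
    ...   | no x≢a = a , aV , x≢a , la
    go : Dec (NonLeader G x) → ∃ λ x → x ∈ N ++ W × Uncovered V x
    go (yes p) = x , ∈-++⁺ˡ (∈N⁺ (p , lx)) , unc
    go (no gx) with another
    ... | y , yV , x≢y , ly with split? V y
    ...   | no ¬s = y , ∈-++⁺ˡ (∈N⁺ (other-new gx yV x≢y ly)) , yV , ¬s
    ...   | yes s with find s
    ...     | U , U∈ , proper U⊆V V⊈U , _ with two-leaders U∈
    -- `U` misses `x`, where `V` is uncovered, so both `D₂`-leaders in `U` differ from `x` and are
    -- new. Hence `x` is wealthy.
    ...       | a , b , aU , bU , a≢b , la , lb =
      x , ∈-++⁺ʳ N (∈-filter⁺ wealthy? (∈-allFin x) (gx , a , b , a≢b , new aU la , new bU lb)) , unc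
      where
      new : ∀ {z} → z ∈ˢ U → ¬ NonLeader D₂ z → New z × ¬ Apart G x z
      new zU lz = other-new gx (U⊆V zU) (λ { refl → V⊈U (uncovered-⊆ unc U∈ U⊆V zU) }) lz , linked V∈ xV (U⊆V zU)

  uniqueL : Unique L₀
  uniqueL = Uniq.filter⁺ (¬? ∘ saturated? G) u

  -- There are at most 3/2 times `length N` charging places; both sides are doubled to avoid the
  -- fraction.
  length-J : 2 * length J ≤ 3 * (length N * suc k′)
  length-J = begin
    2 * length J                          ≤⟨ ℕ.*-monoʳ-≤ 2 (charge uncovered? (suc k′) (N ++ W)
      (Uniq.filter⁺ irreducible? uniqueL) charge-irreducible
      λ x zs uz h → uncovered-fibre x zs uz λ V∈ → J⊆L (proj₁ (h V∈)) , proj₂ (h V∈)) ⟩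
    2 * (length (N ++ W) * suc k′)        ≡⟨ cong (λ m → 2 * (m * suc k′)) (length-++ N) ⟩
    2 * ((length N + length W) * suc k′)
      ≡⟨ solve 3 (λ a b k → con 2 :* ((a :+ b) :* k) := con 2 :* (a :* k) :+ con 2 :* b :* k) refl
           (length N) (length W) (suc k′) ⟩
    2 * (length N * suc k′) + 2 * length W * suc k′
      ≤⟨ ℕ.+-monoʳ-≤ (2 * (length N * suc k′)) (ℕ.*-monoˡ-≤ (suc k′) length-W) ⟩
    2 * (length N * suc k′) + length N * suc k′
      ≡⟨ solve 1 (λ a → con 2 :* a :+ a := con 3 :* a) refl (length N * suc k′) ⟩
    3 * (length N * suc k′)               ∎
    where
    open ℕ.≤-Reasoning
    open +-*-Solver

  -- Minimal members, and the traces of the others.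

  Minimal : Subset n → Set
  Minimal V = ¬ Any (λ W → Proper W V) L₀

  minimal? : ∀ V → Dec (Minimal V)
  minimal? V = ¬? (any? (λ W → proper? W V) L₀)

  -- A minimal set is uncovered at each of its points, so it can be charged to the new point
  -- supplied by `some-new`.
  length-minimal : length (filter minimal? L₀) ≤ length N * suc k′
  length-minimal = charge uncovered? (suc k′) N (Uniq.filter⁺ minimal? uniqueL) ch
    λ x zs uz h → uncovered-fibre x zs uz λ V∈ → proj₁ (∈-filter⁻ minimal? (proj₁ (h V∈))) , proj₂ (h V∈)
    where
    ch : ∀ {V} → V ∈ filter minimal? L₀ → ∃ λ x → x ∈ N × Uncovered V x
    ch V∈ with ∈-filter⁻ minimal? {xs = L₀} V∈
    ... | V∈L , mn with some-new V∈L
    ...   | x , x∈N , xV = x , x∈N , xV , λ s → mn (Any.map proj₁ s)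

  R : List (Subset n)
  R = filter (¬? ∘ minimal?) L₀

  R⊆L : ∀ {V} → V ∈ R → V ∈ L₀
  R⊆L V∈ = proj₁ (∈-filter⁻ (¬? ∘ minimal?) V∈)

  -- The irreducible members become the points of a new ground set, to which the induction
  -- hypothesis for `k′` is applied.
  trace : Subset n → Subset (length J)
  trace V = tabulate λ i → does (lookup J i ⊆ˢ? V)

  trace⁺ : ∀ {V i} → lookup J i ⊆ˢ V → i ∈ˢ trace V
  trace⁺ {V} {i} p = lookup⇒[]= i (trace V) (trans (lookup∘tabulate _ i) (dec-true (lookup J i ⊆ˢ? V) p))

  trace⁻ : ∀ {V i} → i ∈ˢ trace V → lookup J i ⊆ˢ V
  trace⁻ {V} {i} i∈ with lookup J i ⊆ˢ? V in eq
  ... | yes p = p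
  ... | no ¬p with trans (sym ([]=⇒lookup i∈)) (trans (lookup∘tabulate _ i) (cong does eq))
  ...   | ()

  trace-mono : ∀ {V W} → V ⊆ˢ W → trace V ⊆ˢ trace W
  trace-mono V⊆W i∈ = trace⁺ λ z → V⊆W (trace⁻ i∈ z)

  trace-incomparable : ∀ {V W} → Incomparable (trace V) (trace W) → Incomparable V W
  trace-incomparable (p , q) = (λ V⊆W → p (trace-mono V⊆W)) , λ W⊆V → q (trace-mono W⊆V)

  abstract
    below-trace : ∀ {V x} → V ∈ L₀ → x ∈ˢ V → ∃ λ i → i ∈ˢ trace V × x ∈ˢ lookup J i
    below-trace {V} {x} V∈ xV with below V∈ xV
    ... | I , I∈ , xI , I⊆V = Any.index I∈ ,
      trace⁺ (subst (_⊆ˢ V) (lookup-index I∈) I⊆V) , subst (x ∈ˢ_) (lookup-index I∈) xI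

  -- By `below`, a member of `L₀` is the union of the irreducible members inside it.
  trace-reflects : ∀ {V W} → V ∈ L₀ → trace V ⊆ˢ trace W → V ⊆ˢ W
  trace-reflects V∈ t xV with below-trace V∈ xV
  ... | i , i∈ , xI = trace⁻ (t i∈) xI

  trace-unique : Unique (map trace R)
  trace-unique = AllPairs.map⁺ (AllPairs-from (Uniq.filter⁺ (¬? ∘ minimal?) uniqueL) λ V∈ W∈ V≢W eq →
    V≢W (⊆ˢ-antisym (trace-reflects (R⊆L V∈) (λ {i} → subst (i ∈ˢ_) eq))
      (trace-reflects (R⊆L W∈) (λ {i} → subst (i ∈ˢ_) (sym eq)))))

  -- An irreducible set through a point of `V` outside a smaller `U` differs from every irreducible
  -- set inside `U`. Minimal members are counted apart because their trace is a single point.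
  trace-big : ∀ {V} → V ∈ R → Big (trace V)
  trace-big {V} V∈ with ∈-filter⁻ (¬? ∘ minimal?) {xs = L₀} V∈
  ... | V∈L , ¬mn with find (decidable-stable (any? (λ W → proper? W V) L₀) ¬mn)
  ...   | U , U∈ , proper U⊆V V⊈U with ⊈-witness V U V⊈U | All.lookup big (L⊆ {G} U∈)
  ...     | x , xV , x∉U | y , _ , yU , _ with below-trace V∈L xV | below-trace U∈ yU
  ...       | i , i∈ , xI | j , j∈ , _ = i , j , i∈ , trace-mono U⊆V j∈ , λ { refl → x∉U (trace⁻ j∈ xI) }

  abstract
    preimages : ∀ 𝓑 → (∀ {B} → B ∈ 𝓑 → B ∈ map trace R) → ∃ λ 𝓐 → 𝓑 ≡ map trace 𝓐 × All (_∈ R) 𝓐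
    preimages [] _ = [] , refl , []
    preimages (B ∷ 𝓑) h with ∈-map⁻ trace (h (here refl)) | preimages 𝓑 (h ∘ there)
    ... | A , A∈ , refl | 𝓐 , refl , all = A ∷ 𝓐 , refl , A∈ ∷ all

  -- More than `k′` incomparable traces through `i` would come from incomparable members of `G`
  -- above `lookup J i`, and the first `suc k′` of these would saturate this member of `L₀`.
  trace-wide : Wide k′ (map trace R)
  trace-wide i 𝓑 inc h with preimages 𝓑 (proj₁ ∘ h)
  ... | 𝓐 , refl , all with ℕ.≤-<-connex (length (map trace 𝓐)) k′
  ...   | inj₁ le = le
  ...   | inj₂ gt = contradiction (saturated⁺ {G} (take (suc k′) 𝓐) (AllPairs.take⁺ (suc k′) inc𝓐)
      (All.lookup (All.take⁺ (suc k′) above))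
      (trans (length-take (suc k′) 𝓐) (ℕ.m≤n⇒m⊓n≡m (subst (suc k′ ≤_) (length-map trace 𝓐) gt))))
      (L-unsaturated {G} (J⊆L (∈-lookup i)))
    where
    inc𝓐 : AllPairs Incomparable 𝓐
    inc𝓐 = AllPairs.map trace-incomparable (AllPairs.map⁻ inc)
    above : All (λ A → A ∈ G × lookup J i ⊆ˢ A) 𝓐
    above = All.tabulate member
      where
      member : ∀ {A} → A ∈ 𝓐 → A ∈ G × lookup J i ⊆ˢ A
      member A∈ = L⊆ {G} (R⊆L (All.lookup all A∈)) , trace⁻ (proj₂ (h (∈-map⁺ trace A∈)))

  length-R : length R ≤ g * length J
  length-R = subst (_≤ g * length J) (length-map trace R)
    (bound (map trace R) trace-unique (All.map⁺ (All.tabulate trace-big)) trace-wide)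

  length-L : 2 * length L₀ ≤ (2 * suc k′ + 3 * (suc k′ * g)) * length N
  length-L = begin
    2 * length L₀
      ≡⟨ cong (2 *_) (length-split minimal? L₀) ⟩
    2 * (length (filter minimal? L₀) + length R)
      ≤⟨ ℕ.*-monoʳ-≤ 2 (ℕ.+-mono-≤ length-minimal length-R) ⟩
    2 * (length N * suc k′ + g * length J)
      ≡⟨ solve 4 (λ a k g j → con 2 :* (a :* k :+ g :* j) := con 2 :* k :* a :+ g :* (con 2 :* j)) refl
           (length N) (suc k′) g (length J) ⟩
    2 * suc k′ * length N + g * (2 * length J)
      ≤⟨ ℕ.+-monoʳ-≤ (2 * suc k′ * length N) (ℕ.*-monoʳ-≤ g length-J) ⟩
    2 * suc k′ * length N + g * (3 * (length N * suc k′))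
      ≡⟨ solve 3 (λ a k g → con 2 :* k :* a :+ g :* (con 3 :* (a :* k)) := (con 2 :* k :+ con 3 :* (k :* g)) :* a) refl
           (length N) (suc k′) g ⟩
    (2 * suc k′ + 3 * (suc k′ * g)) * length N ∎
    where
    open ℕ.≤-Reasoning
    open +-*-Solver

-- Telescoping over the layers.

module Step (k″ g : ℕ) (bound : Bound (suc k″) g) where

  private
    k = suc (suc k″)
    c = 2 * k + 3 * (k * g)

  module _ (n : ℕ) where
    open Saturation n k

    -- A largest member `M` is not saturated: as `k` is at least 2, two incomparable members would
    -- contain `M`, but by size the first lies inside `M` and hence inside the other.
    D-shorter : (G : List (Subset n)) → ∀ {V} → V ∈ G → length (D G) < length G
    D-shorter G V∈ with largest ∣_∣ V∈
    ... | M , M∈ , top = filter-notAll (saturated? G) G (lose M∈ unsaturated)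
      where
      unsaturated : ¬ Saturated G M
      unsaturated s with saturated⁻ {G} s
      ... | A ∷ B ∷ _ , ((A⊈B , _) ∷ _) ∷ _ , h , _ = A⊈B λ a →
        proj₂ (h (there (here refl))) (⊆-by-size (proj₂ (h (here refl))) (top (proj₁ (h (here refl)))) a)

    -- The layer `L G` is paid for by `rank G` minus `rank (D (D G))`, two levels down, so the
    -- telescoping bound carries two consecutive ranks. `m` is fuel, decreasing since `D G` is
    -- shorter.
    layers : ∀ m (G : List (Subset n)) → length G ≤ m → Unique G → All Big G → Wide k G →
      2 * length G ≤ c * (rank G + rank (D G))
    layers m [] _ _ _ _ = z≤n
    layers (suc m) G@(_ ∷ _) le u big w = begin
      2 * length G
        ≡⟨ cong (2 *_) (length-split (saturated? G) G) ⟩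
      2 * (length (D G) + length (L G))
        ≡⟨ ℕ.*-distribˡ-+ 2 (length (D G)) (length (L G)) ⟩
      2 * length (D G) + 2 * length (L G)
        ≤⟨ ℕ.+-mono-≤ (layers m (D G) (ℕ.≤-pred (ℕ.<-≤-trans (D-shorter G (here refl)) le))
             (Uniq.filter⁺ (saturated? G) u) (All.tabulate λ V∈ → All.lookup big (D⊆ {G} V∈)) (Wide-⊆ (D⊆ {G}) w))
             length-L ⟩
      c * (rank (D G) + rank (D (D G))) + c * length N
        ≡⟨ solve 4 (λ c a b d → c :* (a :+ b) :+ c :* d := c :* ((b :+ d) :+ a)) refl
             c (rank (D G)) (rank (D (D G))) (length N) ⟩
      c * ((rank (D (D G)) + length N) + rank (D G))
        ≤⟨ ℕ.*-monoʳ-≤ c (ℕ.+-monoˡ-≤ (rank (D G)) rank-N) ⟩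
      c * (rank G + rank (D G)) ∎
      where
      open Layer n (suc k″) g bound G u big w using (N; rank-N; length-L)
      open ℕ.≤-Reasoning
      open +-*-Solver

  step : Bound k c
  step {n} G u big w = ℕ.*-cancelˡ-≤ 2 (begin
    2 * length G               ≤⟨ layers n (length G) G ℕ.≤-refl u big w ⟩
    c * (rank G + rank (D G))  ≤⟨ ℕ.*-monoʳ-≤ c (ℕ.+-mono-≤ (#≤n (nonLeader? G)) (#≤n (nonLeader? (D G)))) ⟩
    c * (n + n)                ≡⟨ solve 2 (λ c n → c :* (n :+ n) := con 2 :* (c :* n)) refl c n ⟩
    2 * (c * n)                ∎)
    where
    open Saturation n k using (D)
    open ℕ.≤-Reasoning
    open +-*-Solver

-- The constants.

growth : ℕ → ℕ
growth zero = 3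
growth (suc j) = 2 * (3 + j) + 3 * ((3 + j) * growth j)

growth-bound : ∀ j → Bound (2 + j) (growth j)
growth-bound zero {m} G u big w with two-wide G u big w
... | inj₁ refl = z≤n
... | inj₂ le = ℕ.≤-trans (ℕ.m≤m+n (length G) 1) le
growth-bound (suc j) = Step.step (suc j) (growth j) (growth-bound j)

-- The left side consists of the first two terms of the binomial expansion.
bernoulli : ∀ b d m → b ^ suc m + suc m * d * b ^ m ≤ (b + d) ^ suc m
bernoulli b d zero = ℕ.≤-reflexive
  (solve 2 (λ b d → b :* con 1 :+ (d :+ con 0) :* con 1 := (b :+ d) :* con 1) refl b d)
  where open +-*-Solver
bernoulli b d (suc m) = begin
  b ^ (2 + m) + (2 + m) * d * b ^ suc m
    -- The added term makes the sum factor as `b + d` times the left side of the induction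
    -- hypothesis.
    ≤⟨ ℕ.m≤m+n _ (d * (suc m * d * b ^ m)) ⟩
  b * (b * b ^ m) + (2 + m) * d * (b * b ^ m) + d * (suc m * d * b ^ m)
    ≡⟨ solve 4 (λ b d m p → b :* (b :* p) :+ (con 2 :+ m) :* d :* (b :* p) :+ d :* ((con 1 :+ m) :* d :* p)
         := (b :+ d) :* (b :* p :+ (con 1 :+ m) :* d :* p)) refl b d m (b ^ m) ⟩
  (b + d) * (b ^ suc m + suc m * d * b ^ m)
    ≤⟨ ℕ.*-monoʳ-≤ (b + d) (bernoulli b d m) ⟩
  (b + d) ^ (2 + m) ∎
  where
  open ℕ.≤-Reasoning
  open +-*-Solver

-- With `k = 2 + j` this says (1 + 1/k)^(k - 1) ≥ 3/2; Bernoulli's inequality gives 1 + (k - 1)/k,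
-- which suffices as k ≥ 2.
three-halves : ∀ j → 3 * (2 * (2 + j)) ^ suc j ≤ 2 * (2 * (3 + j)) ^ suc j
three-halves j = begin
  3 * (b * b ^ j)                            ≡⟨ solve 1 (λ x → con 3 :* x := con 2 :* x :+ x) refl (b * b ^ j) ⟩
  2 * (b * b ^ j) + b * b ^ j                ≤⟨ ℕ.+-monoʳ-≤ (2 * (b * b ^ j)) (ℕ.*-monoˡ-≤ (b ^ j) b≤) ⟩
  2 * (b * b ^ j) + 2 * (suc j * 2) * b ^ j  ≡⟨ solve 3 (λ x y z → con 2 :* x :+ con 2 :* y :* z := con 2 :* (x :+ y :* z))
                                                 refl (b * b ^ j) (suc j * 2) (b ^ j) ⟩
  2 * (b ^ suc j + suc j * 2 * b ^ j)        ≤⟨ ℕ.*-monoʳ-≤ 2 (bernoulli b 2 j) ⟩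
  2 * (b + 2) ^ suc j                        ≡⟨ cong (λ c → 2 * c ^ suc j)
                                                 (solve 1 (λ j → con 2 :* (con 2 :+ j) :+ con 2 := con 2 :* (con 3 :+ j)) refl j) ⟩
  2 * (2 * (3 + j)) ^ suc j                  ∎
  where
  open ℕ.≤-Reasoning
  open +-*-Solver
  b = 2 * (2 + j)
  b≤ : b ≤ 2 * (suc j * 2)
  b≤ = ℕ.≤-trans (ℕ.m≤m+n b (2 * j)) (ℕ.≤-reflexive
    (solve 1 (λ j → con 2 :* (con 2 :+ j) :+ con 2 :* j := con 2 :* ((con 1 :+ j) :* con 2)) refl j))

-- The slack rises from 1 to 2: the recursion consumes 1, and 2 is what the small sets cost in the
-- end. For `j = 0` the hypothesis is the equality 3 + 1 = 4.
growth-step : ∀ j → growth j + 1 ≤ (2 * (2 + j)) ^ suc j → growth (suc j) + 2 ≤ (2 * (3 + j)) ^ (2 + j)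
growth-step j ih = begin
  2 * (3 + j) + 3 * ((3 + j) * growth j) + 2
    -- Together with the 2 this makes a third copy of `3 + j`, so that `3 * (3 + j)` factors out.
    ≤⟨ ℕ.m≤m+n _ (1 + j) ⟩
  2 * (3 + j) + 3 * ((3 + j) * growth j) + 2 + (1 + j)
    ≡⟨ solve 2 (λ j g → con 2 :* (con 3 :+ j) :+ con 3 :* ((con 3 :+ j) :* g) :+ con 2 :+ (con 1 :+ j)
         := (con 3 :+ j) :* (con 3 :* (g :+ con 1))) refl j (growth j) ⟩
  (3 + j) * (3 * (growth j + 1))
    ≤⟨ ℕ.*-monoʳ-≤ (3 + j) (ℕ.≤-trans (ℕ.*-monoʳ-≤ 3 ih) (three-halves j)) ⟩
  (3 + j) * (2 * (2 * (3 + j)) ^ suc j)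
    ≡⟨ solve 2 (λ k p → k :* (con 2 :* p) := con 2 :* k :* p) refl (3 + j) ((2 * (3 + j)) ^ suc j) ⟩
  (2 * (3 + j)) ^ (2 + j) ∎
  where
  open ℕ.≤-Reasoning
  open +-*-Solver

growth-≤ : ∀ j → growth j + 1 ≤ (2 * (2 + j)) ^ suc j
growth-≤ zero = ℕ.≤-refl
growth-≤ (suc j) = ℕ.≤-trans (ℕ.+-monoʳ-≤ (growth (suc j)) (s≤s z≤n)) (growth-step j (growth-≤ j))

-- Small sets and the conclusion.

big? : ∀ {n} (V : Subset n) → Dec (Big V)
big? V = F.any? λ x → F.any? λ y → x ∈ˢ? V ×-dec y ∈ˢ? V ×-dec ¬? (x F.≟ y)

-- Only the empty set and the `n` singletons are available.
length-small : ∀ {n} {G : List (Subset n)} → Unique G → (∀ {V} → V ∈ G → ¬ Big V) → length G ≤ suc n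
length-small {n} {G} u small = subst (length G ≤_)
  (cong suc (trans (length-map ⁅_⁆ (allFin n)) (length-tabulate (λ x → x))))
  (Unique-length u trivial)
  where
  trivial : ∀ {V} → V ∈ G → V ∈ ⊥ ∷ map ⁅_⁆ (allFin n)
  trivial {V} V∈ with nonempty? V
  ... | no empty = here (Empty-unique empty)
  ... | yes (x , xV) = there (subst (_∈ map ⁅_⁆ (allFin n)) (⊆ˢ-antisym ⁅x⁆⊆V V⊆⁅x⁆) (∈-map⁺ ⁅_⁆ (∈-allFin x)))
    where
    ⁅x⁆⊆V : ⁅ x ⁆ ⊆ˢ V
    ⁅x⁆⊆V y∈ = subst (_∈ˢ V) (sym (x∈⁅y⁆⇒x≡y x y∈)) xV
    V⊆⁅x⁆ : V ⊆ˢ ⁅ x ⁆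
    V⊆⁅x⁆ {y} yV = subst (_∈ˢ ⁅ x ⁆)
      (decidable-stable (x F.≟ y) λ x≢y → small V∈ (x , y , xV , yV , x≢y)) (x∈⁅x⁆ x)

locallyWide⇒wide : ∀ {n k} (𝓕 : Family n) → LocallyWide k 𝓕 → Wide k (members 𝓕)
locallyWide⇒wide 𝓕 lw x 𝓐 inc h = lw x (family 𝓐 (antichain-unique inc))
  (λ A∈ → ∈-filter⁺ (x ∈ˢ?_) (proj₁ (h A∈)) (proj₂ (h A∈))) λ U V U∈ V∈ → equal inc U∈ V∈
  where
  equal : ∀ {𝓐 U V} → AllPairs Incomparable 𝓐 → U ∈ 𝓐 → V ∈ 𝓐 → U ⊆ˢ V → U ≡ V
  equal _ (here refl) (here refl) _ = refl
  equal (a ∷ _) (here refl) (there V∈) U⊆V = contradiction (λ {x} → U⊆V {x}) (proj₁ (All.lookup a V∈))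
  equal (a ∷ _) (there U∈) (here refl) U⊆V = contradiction (λ {x} → U⊆V {x}) (proj₂ (All.lookup a U∈))
  equal (_ ∷ as) (there U∈) (there V∈) U⊆V = equal as U∈ V∈ U⊆V

theorem3p8p1 : ∀ (k n : ℕ) → 2 ≤ k → 1 ≤ n → (𝓕 : Family n) →
    LocallyWide k 𝓕 → card 𝓕 ≤ (2 * k) ^ (k ∸ 1) * n
theorem3p8p1 (suc zero) n (s≤s ()) 1≤n 𝓕 lw
theorem3p8p1 (suc (suc j)) n 2≤k 1≤n 𝓕 lw = begin
  length (members 𝓕)                    ≡⟨ length-split big? (members 𝓕) ⟩
  length 𝓖 + length (filter (¬? ∘ big?) (members 𝓕))
    ≤⟨ ℕ.+-monoʳ-≤ (length 𝓖) (length-small (Uniq.filter⁺ (¬? ∘ big?) (unique 𝓕))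
         λ V∈ → proj₂ (∈-filter⁻ (¬? ∘ big?) {xs = members 𝓕} V∈)) ⟩
  length 𝓖 + suc n                      ≤⟨ large j wide ⟩
  (2 * (2 + j)) ^ suc j * n             ∎
  where
  open ℕ.≤-Reasoning
  open +-*-Solver
  𝓖 = filter big? (members 𝓕)
  wide : Wide (2 + j) 𝓖
  wide = Wide-⊆ (λ V∈ → proj₁ (∈-filter⁻ big? V∈)) (locallyWide⇒wide 𝓕 lw)
  unique𝓖 : Unique 𝓖
  unique𝓖 = Uniq.filter⁺ big? (unique 𝓕)
  big𝓖 : All Big 𝓖
  big𝓖 = All.all-filter big? (members 𝓕)
  large : ∀ j → Wide (2 + j) 𝓖 → length 𝓖 + suc n ≤ (2 * (2 + j)) ^ suc j * n
  -- The target is `4 * n`: the `n + 1` small sets fit exactly, because `two-wide` saves 1.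
  large zero w with two-wide 𝓖 unique𝓖 big𝓖 w
  ... | inj₁ empty rewrite empty = ℕ.≤-trans (ℕ.+-monoˡ-≤ n 1≤n) (ℕ.+-monoʳ-≤ n (ℕ.m≤m+n n _))
  ... | inj₂ le = begin
    length 𝓖 + suc n    ≡⟨ solve 2 (λ g n → g :+ (con 1 :+ n) := n :+ (g :+ con 1)) refl (length 𝓖) n ⟩
    n + (length 𝓖 + 1)  ≤⟨ ℕ.+-monoʳ-≤ n le ⟩
    n + 3 * n           ∎
  -- Here `suc n` is at most `n + n`, which the slack of 2 in `growth-step` absorbs.
  large (suc j) w = begin
    length 𝓖 + suc n              ≤⟨ ℕ.+-mono-≤ (growth-bound (suc j) 𝓖 unique𝓖 big𝓖 w) (ℕ.+-monoˡ-≤ n 1≤n) ⟩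
    growth (suc j) * n + (n + n)  ≡⟨ solve 2 (λ g n → g :* n :+ (n :+ n) := (g :+ con 2) :* n) refl (growth (suc j)) n ⟩
    (growth (suc j) + 2) * n      ≤⟨ ℕ.*-monoˡ-≤ n (growth-step j (growth-≤ j)) ⟩
    (2 * (3 + j)) ^ (2 + j) * n   ∎
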